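{- As formal power series in $q$ (equivalently, for $|q|<1$), $$\sum_{n=0}^{\infty}\sigma_{od}\mathrm{moex}(n)\,q^n= \frac{(-q;q^2)_{\infty}}{(q^2;q^2)_{\infty}}\bigl(1+\sigma^*(-q)\bigr)$$ and $$\sum_{n=0}^{\infty}\sigma_{od}\mathrm{meex}(n)\,q^n=2 \sum_{n=0}^{\infty}p_{ed}(n)q^n,$$ where $\sigma^*(q):=2\sum_{n=1}^{\infty}\frac{(-1)^nq^{n^2}}{(q;q^2)_n}$.
   Context: Notation: $(a;q)_0:=1$, $(a;q)_n:=\prod_{k=0}^{n-1}(1-aq^k)$, $(a;q)_\infty:=\lim_{n\to\infty}(a;q)_n$. For $n\ge 0$, $\mathcal{P}_{od}(n)$ is the set of all partitions of $n$ in which no odd part is repeated (even parts may appear with any multiplicity), and $p_{ed}(n)$ is the number of partitions of $n$ in which no even part is repeated (odd parts may appear with any multiplicity), with $p_{ed}(0)=1$. The empty partition is the unique element of $\mathcal{P}_{od}(0)$. For $\lambda\in\mathcal{P}_{od}(n)$, $\mathrm{moex}(\lambda)$ (resp. $\mathrm{meex}(\lambda)$) is the smallest positive odd (resp. positive even) integer that is not a part of $\lambda$. Define $$\sigma_{od}\mathrm{moex}(n):=\sum_{\lambda\in\mathcal{P}_{od}(n)}\mathrm{moex}(\lambda),\qquad \sigma_{od}\mathrm{meex}(n):=\sum_{\lambda\in\mathcal{P}_{od}(n)}\mathrm{meex}(\lambda).$$ -}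

module Defs where

open import Data.Nat as ℕ using (ℕ; zero; suc; _≤_; _<_; _≥_; z≤n; s≤s; _∸_)
import Data.Nat.Properties as ℕₚ
open import Data.Nat.Divisibility using (_∣_; _∣?_; m∣m*n; ∣m+n∣m⇒∣n; ∣1⇒≡1)
open import Data.Integer as ℤ using (ℤ; +_; 0ℤ; 1ℤ; -1ℤ)
import Data.Integer.Properties as ℤₚ
open import Data.List using (List; []; _∷_; _++_; map; filter; length)
open import Data.List.Membership.Propositional using (_∈_; _∉_)
open import Data.List.Membership.DecPropositional ℕ._≟_ using (_∈?_)
open import Data.List.Membership.Propositional.Properties using (∈-++⁺ˡ; ∈-++⁺ʳ; ∈-++⁻; ∈-map⁺; ∈-map⁻; ∈-filter⁺; ∈-filter⁻)
open import Data.List.Properties using (∷-injectiveʳ)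
open import Data.List.Relation.Unary.All as All using (All; []; _∷_)
open import Data.List.Relation.Unary.AllPairs using (AllPairs; []; _∷_)
open import Data.List.Relation.Unary.Any using (here; there)
open import Data.List.Relation.Unary.Unique.Propositional using (Unique)
import Data.List.Relation.Unary.Unique.Propositional.Properties as Uniqueₚ
open import Data.Nat.ListAction using (sum)
open import Data.Product using (∃; _×_; _,_; proj₁; proj₂)
open import Data.Sum using (inj₁; inj₂)
open import Function using (_∘_)
open import Function.Bundles using (_⇔_; mk⇔)
open import Level using (0ℓ)
open import Relation.Binary.PropositionalEquality using (_≡_; refl; sym; trans; cong; cong₂; subst; module ≡-Reasoning)
open import Relation.Nullary using (¬_; yes; no; ¬?; contradiction)
open import Relation.Nullary.Decidable using (_×-dec_; _→-dec_)
open import Relation.Unary using (Pred; Decidable)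

-- Formal power series over ℤ: the series ∑ f(n) qⁿ is its coefficient
-- function f.

Series : Set
Series = ℕ → ℤ

infix  4 _≈ₛ_
infixl 6 _+ₛ_ _-ₛ_
infixl 7 _*ₛ_ _/ₛ_
infix  8 -ₛ_
infixr 9 _^ₛ_

_≈ₛ_ : Series → Series → Set
f ≈ₛ g = ∀ n → f n ≡ g n

-- ∑< n f = f 0 + … + f (n - 1)
∑< : ℕ → (ℕ → ℤ) → ℤ
∑< zero    f = 0ℤ
∑< (suc n) f = ∑< n f ℤ.+ f n

const : ℤ → Series
const c zero    = c
const c (suc _) = 0ℤ

1ₛ : Series
1ₛ = const 1ℤ

q : Series
q (suc zero) = 1ℤ
q _          = 0ℤ

_+ₛ_ : Series → Series → Series
(f +ₛ g) n = f n ℤ.+ g n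

-ₛ_ : Series → Series
(-ₛ f) n = ℤ.- f n

_-ₛ_ : Series → Series → Series
f -ₛ g = f +ₛ (-ₛ g)

_*ₛ_ : Series → Series → Series
(f *ₛ g) n = ∑< (suc n) λ k → f k ℤ.* g (n ∸ k)

_^ₛ_ : Series → ℕ → Series
f ^ₛ zero  = 1ₛ
f ^ₛ suc n = f ^ₛ n *ₛ f

-- f(-q)
_[-q] : Series → Series
(f [-q]) n = (-1ℤ ℤ.^ n) ℤ.* f n

-- The coefficients of 1/g up to degree n, for g with constant term 1, from
--   (1/g)(0) = 1,   (1/g)(n+1) = - ∑_{j ≤ n} g(j+1) (1/g)(n-j);
-- the values beyond degree n are meaningless.  See *ₛ-inverseʳ below.
inverseUpTo : Series → ℕ → Series
inverseUpTo g zero    k = 1ℤ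
inverseUpTo g (suc n) k with k ℕ.≤? n
... | yes _ = inverseUpTo g n k
... | no  _ = ℤ.- ∑< (suc n) λ j → g (suc j) ℤ.* inverseUpTo g n (n ∸ j)

inverse : Series → Series
inverse g n = inverseUpTo g n n

-- Only meaningful when g has constant term 1.
_/ₛ_ : Series → Series → Series
f /ₛ g = f *ₛ inverse g

-- Limits in the q-adic topology: every coefficient is eventually constant.

Convergent : (ℕ → Series) → Set
Convergent s = ∀ k → ∃ λ N → ∀ m → N ≤ m → s m k ≡ s N k

lim : (s : ℕ → Series) → Convergent s → Series
lim s c k = s (proj₁ (c k)) k

partialSums : (ℕ → Series) → ℕ → Series
partialSums t N k = ∑< N λ n → t n k

∑∞ : (t : ℕ → Series) → Convergent (partialSums t) → Series
∑∞ t = lim (partialSums t)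

-- (a;b)_n = ∏_{k<n} (1 - a bᵏ)
poch : Series → Series → ℕ → Series
poch a b zero    = 1ₛ
poch a b (suc n) = poch a b n *ₛ (1ₛ -ₛ a *ₛ b ^ₛ n)

∑<-cong : ∀ n {f g : ℕ → ℤ} → (∀ k → k < n → f k ≡ g k) → ∑< n f ≡ ∑< n g
∑<-cong zero    e = refl
∑<-cong (suc n) e =
  cong₂ ℤ._+_ (∑<-cong n λ k k<n → e k (ℕₚ.m<n⇒m<1+n k<n)) (e n ℕₚ.≤-refl)

∑<-zero : ∀ n {f : ℕ → ℤ} → (∀ k → k < n → f k ≡ 0ℤ) → ∑< n f ≡ 0ℤ
∑<-zero zero    e = refl
∑<-zero (suc n) e =
  cong₂ ℤ._+_ (∑<-zero n λ k k<n → e k (ℕₚ.m<n⇒m<1+n k<n)) (e n ℕₚ.≤-refl)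

∑<-head : ∀ n (f : ℕ → ℤ) → ∑< (suc n) f ≡ f 0 ℤ.+ ∑< n (f ∘ suc)
∑<-head zero    f = ℤₚ.+-comm 0ℤ (f 0)
∑<-head (suc n) f = trans (cong (ℤ._+ f (suc n)) (∑<-head n f))
                          (ℤₚ.+-assoc (f 0) (∑< n (f ∘ suc)) (f (suc n)))

-- qⁿ divides f
Vanishes : ℕ → Series → Set
Vanishes n f = ∀ k → k < n → f k ≡ 0ℤ

*ₛ-vanishesˡ : ∀ {n} f g → Vanishes n f → Vanishes n (f *ₛ g)
*ₛ-vanishesˡ f g v k k<n = ∑<-zero (suc k) λ { i (s≤s i≤k) →
  cong (ℤ._* g (k ∸ i)) (v i (ℕₚ.≤-<-trans i≤k k<n)) }

*ₛ-vanishesʳ : ∀ {n} f g → Vanishes n g → Vanishes n (f *ₛ g)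
*ₛ-vanishesʳ f g v k k<n = ∑<-zero (suc k) λ i _ →
  trans (cong (f i ℤ.*_) (v (k ∸ i) (ℕₚ.≤-<-trans (ℕₚ.m∸n≤m k i) k<n)))
        (ℤₚ.*-zeroʳ (f i))

^ₛ-vanishes : ∀ f → f 0 ≡ 0ℤ → ∀ n → Vanishes n (f ^ₛ n)
^ₛ-vanishes f f0 (suc n) k (s≤s k≤n) = ∑<-zero (suc k) λ { i (s≤s i≤k) → term i i≤k }
  where
  term : ∀ i → i ≤ k → (f ^ₛ n) i ℤ.* f (k ∸ i) ≡ 0ℤ
  term i i≤k with i ℕ.<? n
  ... | yes i<n = cong (ℤ._* f (k ∸ i)) (^ₛ-vanishes f f0 n i i<n)
  ... | no  i≮n = trans
    (cong (λ j → (f ^ₛ n) i ℤ.* f j) (ℕₚ.m≤n⇒m∸n≡0 (ℕₚ.≤-trans k≤n (ℕₚ.≮⇒≥ i≮n))))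
    (trans (cong ((f ^ₛ n) i ℤ.*_) f0) (ℤₚ.*-zeroʳ ((f ^ₛ n) i)))

const-pos : ∀ c {n} → 0 < n → const c n ≡ 0ℤ
const-pos c (s≤s _) = refl

*ₛ-identityʳ : ∀ f → f *ₛ 1ₛ ≈ₛ f
*ₛ-identityʳ f k = begin
  ∑< k (λ i → f i ℤ.* 1ₛ (k ∸ i)) ℤ.+ f k ℤ.* 1ₛ (k ∸ k)
    ≡⟨ cong₂ ℤ._+_
         (∑<-zero k λ i i<k → trans (cong (f i ℤ.*_) (const-pos 1ℤ (ℕₚ.m<n⇒0<n∸m i<k)))
                                    (ℤₚ.*-zeroʳ (f i)))
         (trans (cong (λ j → f k ℤ.* 1ₛ j) (ℕₚ.n∸n≡0 k)) (ℤₚ.*-identityʳ (f k))) ⟩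
  0ℤ ℤ.+ f k
    ≡⟨ ℤₚ.+-identityˡ (f k) ⟩
  f k ∎
  where open ≡-Reasoning

stabilises : (s : ℕ → Series) → (∀ n k → k < n → s (suc n) k ≡ s n k) → Convergent s
stabilises s step k = suc k , λ m k<m → go m (ℕₚ.≤⇒≤′ k<m)
  where
  go : ∀ m → suc k ℕ.≤′ m → s m k ≡ s (suc k) k
  go _       ℕ.≤′-refl     = refl
  go (suc m) (ℕ.≤′-step p) = trans (step m k (ℕₚ.≤′⇒≤ p)) (go m p)

poch-converges : ∀ a b → b 0 ≡ 0ℤ → Convergent (poch a b)
poch-converges a b b0 = stabilises (poch a b) λ n k k<n →
  trans (∑<-cong (suc k) λ i _ → cong (poch a b n i ℤ.*_) (factor n (k ∸ i)
          (ℕₚ.≤-<-trans (ℕₚ.m∸n≤m k i) k<n)))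
        (*ₛ-identityʳ (poch a b n) k)
  where
  factor : ∀ n j → j < n → (1ₛ -ₛ a *ₛ b ^ₛ n) j ≡ 1ₛ j
  factor n j j<n = trans
    (cong (λ z → 1ₛ j ℤ.- z) (*ₛ-vanishesʳ a (b ^ₛ n) (^ₛ-vanishes b b0 n) j j<n))
    (ℤₚ.+-identityʳ (1ₛ j))

∑-converges : (t : ℕ → Series) → (∀ n → Vanishes n (t n)) → Convergent (partialSums t)
∑-converges t v = stabilises (partialSums t) λ n k k<n → trans
  (cong (λ z → partialSums t n k ℤ.+ z) (v n k k<n))
  (ℤₚ.+-identityʳ (partialSums t n k))

inverseUpTo-stable : ∀ g n k → k ≤ n → inverseUpTo g n k ≡ inverse g k
inverseUpTo-stable g n k k≤n = go n (ℕₚ.≤⇒≤′ k≤n)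
  where
  go : ∀ n → k ℕ.≤′ n → inverseUpTo g n k ≡ inverse g k
  go _       ℕ.≤′-refl = refl
  go (suc n) (ℕ.≤′-step p) with k ℕ.≤? n
  ... | yes _   = go n p
  ... | no  k≰n = contradiction (ℕₚ.≤′⇒≤ p) k≰n

inverse-suc : ∀ g n → inverse g (suc n) ≡ ℤ.- ∑< (suc n) λ j → g (suc j) ℤ.* inverse g (n ∸ j)
inverse-suc g n with suc n ℕ.≤? n
... | yes n<n = contradiction n<n ℕₚ.1+n≰n
... | no  _   = cong ℤ.-_ (∑<-cong (suc n) λ j _ →
  cong (g (suc j) ℤ.*_) (inverseUpTo-stable g n (n ∸ j) (ℕₚ.m∸n≤m n j)))

*ₛ-inverseʳ : ∀ g → g 0 ≡ 1ℤ → g *ₛ inverse g ≈ₛ 1ₛ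
*ₛ-inverseʳ g g0 zero    = cong (λ z → 0ℤ ℤ.+ z ℤ.* 1ℤ) g0
*ₛ-inverseʳ g g0 (suc n) = begin
  ∑< (suc (suc n)) (λ k → g k ℤ.* inverse g (suc n ∸ k))
    ≡⟨ ∑<-head (suc n) (λ k → g k ℤ.* inverse g (suc n ∸ k)) ⟩
  g 0 ℤ.* inverse g (suc n) ℤ.+ S
    ≡⟨ cong (λ z → z ℤ.* inverse g (suc n) ℤ.+ S) g0 ⟩
  1ℤ ℤ.* inverse g (suc n) ℤ.+ S
    ≡⟨ cong (ℤ._+ S) (trans (ℤₚ.*-identityˡ (inverse g (suc n))) (inverse-suc g n)) ⟩
  ℤ.- S ℤ.+ S
    ≡⟨ ℤₚ.+-inverseˡ S ⟩
  0ℤ ∎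
  where
  open ≡-Reasoning
  S = ∑< (suc n) λ j → g (suc j) ℤ.* inverse g (n ∸ j)

-- The series by which the theorem divides have constant term 1.
poch-constant : ∀ a b → a 0 ≡ 0ℤ → ∀ n → poch a b n 0 ≡ 1ℤ
poch-constant a b a0 zero    = refl
poch-constant a b a0 (suc n)
  rewrite poch-constant a b a0 n | a0 = refl

poch∞ : (a b : Series) → b 0 ≡ 0ℤ → Series
poch∞ a b b0 = lim (poch a b) (poch-converges a b b0)

-- (-1)ⁿ q^{n²} / (q;q²)_n
σ*-term : ℕ → Series
σ*-term n = ((-ₛ 1ₛ) ^ₛ n *ₛ q ^ₛ (n ℕ.* n)) /ₛ poch q (q ^ₛ 2) n

σ*-term-vanishes : ∀ n → Vanishes n (σ*-term (suc n))
σ*-term-vanishes n k k<n =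
  *ₛ-vanishesˡ ((-ₛ 1ₛ) ^ₛ suc n *ₛ q ^ₛ (suc n ℕ.* suc n)) (inverse (poch q (q ^ₛ 2) (suc n)))
    (*ₛ-vanishesʳ ((-ₛ 1ₛ) ^ₛ suc n) (q ^ₛ (suc n ℕ.* suc n))
      (^ₛ-vanishes q refl (suc n ℕ.* suc n)))
    k (ℕₚ.<-≤-trans k<n (ℕₚ.≤-trans (ℕₚ.n≤1+n n) (ℕₚ.m≤m*n (suc n) (suc n))))

-- The sum starts at n = 1.
σ* : Series
σ* = const (+ 2) *ₛ ∑∞ (σ*-term ∘ suc) (∑-converges (σ*-term ∘ suc) σ*-term-vanishes)

-- Partitions, as weakly decreasing lists of positive integers.

record IsPartition (n : ℕ) (xs : List ℕ) : Set where
  constructor isPartition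
  field
    decreasing : AllPairs _≥_ xs
    positive   : All (0 <_) xs
    total      : sum xs ≡ n

-- All weakly decreasing lists of length ≤ l with entries in {1, …, k}.
decreasingLists : (l k : ℕ) → List (List ℕ)
decreasingLists zero    k       = [] ∷ []
decreasingLists (suc l) zero    = [] ∷ []
decreasingLists (suc l) (suc k) =
  decreasingLists (suc l) k ++ map (suc k ∷_) (decreasingLists l (suc k))

-- A duplicate-free list of all partitions of n: see ∈-partitions and
-- partitions-unique.
partitions : ℕ → List (List ℕ)
partitions n = filter (λ xs → sum xs ℕ.≟ n) (decreasingLists n n)

Even Odd : ℕ → Set
Even k = 2 ∣ k
Odd  k = ¬ 2 ∣ k

even? : Decidable Even
even? k = 2 ∣? k

odd? : Decidable Odd
odd? k = ¬? (even? k)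

multiplicity : ℕ → List ℕ → ℕ
multiplicity k xs = length (filter (k ℕ.≟_) xs)

NoRepeated : Pred ℕ 0ℓ → List ℕ → Set
NoRepeated P xs = All (λ k → P k → multiplicity k xs ≤ 1) xs

noRepeated? : ∀ {P : Pred ℕ 0ℓ} → Decidable P → Decidable (NoRepeated P)
noRepeated? P? xs = All.all? (λ k → P? k →-dec (multiplicity k xs ℕ.≤? 1)) xs

𝒫od : ℕ → List (List ℕ)
𝒫od n = filter (noRepeated? odd?) (partitions n)

𝒫ed : ℕ → List (List ℕ)
𝒫ed n = filter (noRepeated? even?) (partitions n)

ped : ℕ → ℕ
ped n = length (𝒫ed n)

module _ {P : Pred ℕ 0ℓ} (P? : Decidable P) where

  searchFrom : (fuel start : ℕ) → ℕ
  searchFrom zero       m = m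
  searchFrom (suc fuel) m with P? m
  ... | yes _ = m
  ... | no  _ = searchFrom fuel (suc m)

  -- The smallest m satisfying P, provided some m ≤ bound does.
  least : (bound : ℕ) → ℕ
  least bound = searchFrom bound 0

MissingOdd MissingEven : List ℕ → Pred ℕ 0ℓ
MissingOdd  xs m = 0 < m × Odd m × m ∉ xs
MissingEven xs m = 0 < m × Even m × m ∉ xs

missingOdd? : ∀ xs → Decidable (MissingOdd xs)
missingOdd? xs m = (0 ℕ.<? m) ×-dec odd? m ×-dec ¬? (m ∈? xs)

missingEven? : ∀ xs → Decidable (MissingEven xs)
missingEven? xs m = (0 ℕ.<? m) ×-dec even? m ×-dec ¬? (m ∈? xs)

-- No part exceeds sum xs, so the search bounds suffice: see moex-least and
-- meex-least.
moex : List ℕ → ℕ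
moex xs = least (missingOdd? xs) (suc (2 ℕ.* sum xs))

meex : List ℕ → ℕ
meex xs = least (missingEven? xs) (2 ℕ.* suc (sum xs))

σodmoex σodmeex : ℕ → ℕ
σodmoex n = sum (map moex (𝒫od n))
σodmeex n = sum (map meex (𝒫od n))

-- ∑ a(n) qⁿ
genFun : (ℕ → ℕ) → Series
genFun a n = + a n

record IsLeast (P : Pred ℕ 0ℓ) (m : ℕ) : Set where
  constructor isLeast
  field
    holds   : P m
    minimal : ∀ j → P j → m ≤ j

module _ {P : Pred ℕ 0ℓ} (P? : Decidable P) where

  searchFrom-least : ∀ fuel m b → P b → b ≤ fuel ℕ.+ m → (∀ j → P j → m ≤ j) →
                     IsLeast P (searchFrom P? fuel m)
  searchFrom-least zero m b pb b≤m lo =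
    isLeast (subst P (ℕₚ.≤-antisym b≤m (lo b pb)) pb) lo
  searchFrom-least (suc fuel) m b pb b≤ lo with P? m
  ... | yes pm = isLeast pm lo
  ... | no ¬pm = searchFrom-least fuel (suc m) b pb
    (subst (b ≤_) (sym (ℕₚ.+-suc fuel m)) b≤)
    λ j pj → ℕₚ.≤∧≢⇒< (lo j pj) λ { refl → ¬pm pj }

  least-correct : ∀ {b} → P b → IsLeast P (least P? b)
  least-correct {b} pb =
    searchFrom-least b 0 b pb (ℕₚ.≤-reflexive (sym (ℕₚ.+-identityʳ b))) λ _ _ → z≤n

∈⇒≤sum : ∀ {x xs} → x ∈ xs → x ≤ sum xs
∈⇒≤sum {xs = y ∷ ys} (here refl) = ℕₚ.m≤m+n y (sum ys)
∈⇒≤sum {xs = y ∷ ys} (there p)   = ℕₚ.≤-trans (∈⇒≤sum p) (ℕₚ.m≤n+m (sum ys) y)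

>sum⇒∉ : ∀ {m xs} → sum xs < m → m ∉ xs
>sum⇒∉ s<m m∈ = ℕₚ.<⇒≱ s<m (∈⇒≤sum m∈)

odd-1+2* : ∀ s → Odd (suc (2 ℕ.* s))
odd-1+2* s 2∣ with ∣1⇒≡1 (∣m+n∣m⇒∣n (subst (2 ∣_) (ℕₚ.+-comm 1 (2 ℕ.* s)) 2∣) (m∣m*n s))
... | ()

moex-least : ∀ xs → IsLeast (MissingOdd xs) (moex xs)
moex-least xs = least-correct (missingOdd? xs)
  (s≤s z≤n , odd-1+2* (sum xs) , >sum⇒∉ (s≤s (ℕₚ.m≤m+n (sum xs) _)))

meex-least : ∀ xs → IsLeast (MissingEven xs) (meex xs)
meex-least xs = least-correct (missingEven? xs)
  (s≤s z≤n , m∣m*n (suc (sum xs)) , >sum⇒∉ (ℕₚ.m≤m+n (suc (sum xs)) _))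

record Bounded (l k : ℕ) (xs : List ℕ) : Set where
  constructor bounded
  field
    decreasing : AllPairs _≥_ xs
    positive   : All (0 <_) xs
    parts≤     : All (_≤ k) xs
    length≤    : length xs ≤ l

∈-decreasingLists⁻ : ∀ l k {xs} → xs ∈ decreasingLists l k → Bounded l k xs
∈-decreasingLists⁻ zero    k       (here refl) = bounded [] [] [] z≤n
∈-decreasingLists⁻ (suc l) zero    (here refl) = bounded [] [] [] z≤n
∈-decreasingLists⁻ (suc l) (suc k) p with ∈-++⁻ (decreasingLists (suc l) k) p
... | inj₁ p₁ with ∈-decreasingLists⁻ (suc l) k p₁
...   | bounded d pos b len = bounded d pos (All.map ℕₚ.m≤n⇒m≤1+n b) len
∈-decreasingLists⁻ (suc l) (suc k) p | inj₂ p₂ with ∈-map⁻ (suc k ∷_) p₂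
... | _ , p₃ , refl with ∈-decreasingLists⁻ l (suc k) p₃
...   | bounded d pos b len = bounded (b ∷ d) (s≤s z≤n ∷ pos) (ℕₚ.≤-refl ∷ b) (s≤s len)

[]∈decreasingLists : ∀ l k → [] ∈ decreasingLists l k
[]∈decreasingLists zero    k       = here refl
[]∈decreasingLists (suc l) zero    = here refl
[]∈decreasingLists (suc l) (suc k) = ∈-++⁺ˡ ([]∈decreasingLists (suc l) k)

∈-decreasingLists⁺ : ∀ l k {xs} → Bounded l k xs → xs ∈ decreasingLists l k
∈-decreasingLists⁺ l       k       {[]}     _ = []∈decreasingLists l k
∈-decreasingLists⁺ (suc l) zero    {x ∷ xs} (bounded _ (0<x ∷ _) (x≤0 ∷ _) _) =
  contradiction x≤0 (ℕₚ.<⇒≱ 0<x)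
∈-decreasingLists⁺ (suc l) (suc k) {x ∷ xs} (bounded (d ∷ ds) (p ∷ ps) (b ∷ bs) (s≤s len))
  with x ℕ.≟ suc k
... | yes refl = ∈-++⁺ʳ (decreasingLists (suc l) k)
  (∈-map⁺ (suc k ∷_) (∈-decreasingLists⁺ l (suc k) (bounded ds ps d len)))
... | no  x≢   = ∈-++⁺ˡ (∈-decreasingLists⁺ (suc l) k
  (bounded (d ∷ ds) (p ∷ ps) (x≤k ∷ All.map (λ y≤x → ℕₚ.≤-trans y≤x x≤k) d) (s≤s len)))
  where
  x≤k : x ≤ k
  x≤k = ℕₚ.≤-pred (ℕₚ.≤∧≢⇒< b x≢)

decreasingLists-unique : ∀ l k → Unique (decreasingLists l k)
decreasingLists-unique zero    k       = [] ∷ []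
decreasingLists-unique (suc l) zero    = [] ∷ []
decreasingLists-unique (suc l) (suc k) = Uniqueₚ.++⁺
  (decreasingLists-unique (suc l) k)
  (Uniqueₚ.map⁺ ∷-injectiveʳ (decreasingLists-unique l (suc k)))
  λ { (p , r) → disjoint p r }
  where
  disjoint : ∀ {xs} → xs ∈ decreasingLists (suc l) k →
             ¬ xs ∈ map (suc k ∷_) (decreasingLists l (suc k))
  disjoint p r with ∈-map⁻ (suc k ∷_) r
  ... | _ , _ , refl with ∈-decreasingLists⁻ (suc l) k p
  ...   | bounded _ _ (b ∷ _) _ = ℕₚ.1+n≰n b

length≤sum : ∀ {xs} → All (0 <_) xs → length xs ≤ sum xs
length≤sum []       = z≤n
length≤sum (p ∷ ps) = ℕₚ.+-mono-≤ p (length≤sum ps)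

∈-partitions : ∀ n xs → xs ∈ partitions n ⇔ IsPartition n xs
∈-partitions n xs = mk⇔ to from
  where
  sum? = λ (ys : List ℕ) → sum ys ℕ.≟ n

  to : xs ∈ partitions n → IsPartition n xs
  to p with ∈-filter⁻ sum? {xs = decreasingLists n n} p
  ... | p′ , e with ∈-decreasingLists⁻ n n p′
  ...   | bounded d pos _ _ = isPartition d pos e

  from : IsPartition n xs → xs ∈ partitions n
  from (isPartition d pos refl) = ∈-filter⁺ sum?
    (∈-decreasingLists⁺ n n (bounded d pos (All.tabulate ∈⇒≤sum) (length≤sum pos))) refl

partitions-unique : ∀ n → Unique (partitions n)
partitions-unique n = Uniqueₚ.filter⁺ (λ xs → sum xs ℕ.≟ n) (decreasingLists-unique n n)

{-# OPTIONS --safe #-}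
module Submission where

open import Defs
open import Algebra.Bundles using (CommutativeRing)
import Algebra.Solver.Ring
open import Algebra.Solver.Ring.AlmostCommutativeRing using (fromCommutativeRing; _-Raw-AlmostCommutative⟶_)
open import Algebra.Structures using (IsCommutativeRing)
open import Data.Integer as ℤ using (ℤ; +_; 0ℤ; 1ℤ; -1ℤ)
import Data.Integer.Properties as ℤₚ
open import Data.Integer.Solver using (module +-*-Solver)
open import Data.Nat as ℕ using (ℕ; zero; suc; _≤_; _<_; z≤n; s≤s; _∸_)
open import Data.List using (List; []; _∷_; _++_; map; filter; length)
open import Data.List.Membership.DecPropositional ℕ._≟_ using (_∈?_)
open import Data.List.Membership.Propositional using (_∈_; _∉_)
open import Data.List.Membership.Propositional.Properties using (∈-filter⁺)
open import Data.List.Properties using (filter-accept; filter-reject; filter-none)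
open import Data.List.Relation.Unary.All as All using (All; []; _∷_)
open import Data.List.Relation.Unary.All.Properties using (¬Any⇒All¬)
open import Data.List.Relation.Unary.Any using (here; there)
open import Data.Maybe using (Maybe; just; nothing)
open import Data.Nat.Divisibility using (divides; _∣0; ∣m∣n⇒∣m+n; ∣-refl)
open import Data.Nat.ListAction using (sum)
import Data.Nat.Properties as ℕₚ
open import Data.Nat.Solver using () renaming (module +-*-Solver to ℕ-Solver)
open import Data.Product using (_×_; _,_; proj₁; proj₂; ∃)
open import Function using (_∘_)
open import Level using (0ℓ)
open import Relation.Binary.Bundles using (Setoid)
open import Relation.Binary.PropositionalEquality using (_≡_; _≢_; refl; sym; trans; cong; cong₂; subst; module ≡-Reasoning)
open import Relation.Nullary using (¬_; Dec; yes; no; contradiction)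
open import Relation.Nullary.Decidable using (_×-dec_; decidable-stable)
open import Relation.Unary using (Pred; Decidable)

-- Let P = (-q;q²)∞/(q²;q²)∞ be the generating function of 𝒫od.  Both least
-- missing parts count initial runs of parts: moex λ = 1 + 2 #{m ≥ 1 : 1, 3, …,
-- 2m-1 ∈ λ} and meex λ = 2 #{m ≥ 0 : 2, 4, …, 2m ∈ λ}.  Prescribing the odd
-- parts 1, 3, …, 2m-1 multiplies P by q^{m²}/(-q;q²)_m, which is the m-th term of
-- σ*(-q)/2; prescribing the even parts 2, 4, …, 2m multiplies P by q^{m(m+1)}.
-- So the second series is 2 P ∑ q^{m(m+1)}, and it remains to apply Gauss's
-- ∑ x^{m(m+1)/2} = (x²;x²)∞/(x;x²)∞ with x = q².  Gauss's identity follows from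
-- Shanks's finite form
--   ∑_{m<2N} x^{m(m+1)/2} = ∑_{s<N} x^{s(2N+1)} R_N/R_s,  R_s = (x²;x²)_s/(x;x²)_s,
-- whose right-hand side is R_N modulo x^{2N+1} and telescopes in N.

-- The ring of formal power series

-- No infinite product or sum is ever manipulated. The coefficient of q^n is read with K = n + 1:
-- products with K factors, sums with at least K terms and partitions with parts at most 2K agree
-- with their limits modulo q^K. Between these truncations the product formulas and the effect of
-- prescribed parts are exact; only Gauss's theorem keeps a remainder, which vanishes modulo q^K.
-- Facts about quotients are stated with the denominators multiplied out. Each denominator has
-- constant term 1, so it can be cancelled again, also modulo a power of q. Gauss's theorem yields
-- `ped` because its base-q⁴ products split into conjugate pairs: (q²;q⁴)∞ = (q;q²)∞ (-q;q²)∞ and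
-- (q⁴;q⁴)∞ = (q²;q²)∞ (-q²;q²)∞. Hence P (q⁴;q⁴)∞/(q²;q⁴)∞ collapses to (-q²;q²)∞/(q;q²)∞, the
-- generating function of 𝒫ed.

-- _≈ₛ_ unfolds to a function type, from which Agda cannot recover the two
-- series; the record makes them inferable.
infix 4 _≋_
record _≋_ (f g : Series) : Set where
  constructor coeffs
  field coeff : f ≈ₛ g
open _≋_

0ₛ : Series
0ₛ = const 0ℤ

0ₛ-coeff : ∀ n → 0ₛ n ≡ 0ℤ
0ₛ-coeff zero    = refl
0ₛ-coeff (suc n) = refl

-- Writing f as f(0) + q f′ reduces degree n + 1 to degree n, so the ring laws follow by induction
-- on the degree, without interchanging double sums.
*ₛ-sucˡ : ∀ f g n → (f *ₛ g) (suc n) ≡ f 0 ℤ.* g (suc n) ℤ.+ ((f ∘ suc) *ₛ g) n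
*ₛ-sucˡ f g n = ∑<-head (suc n) (λ k → f k ℤ.* g (suc n ∸ k))

*ₛ-sucʳ : ∀ f g n → (f *ₛ g) (suc n) ≡ (f *ₛ (g ∘ suc)) n ℤ.+ f (suc n) ℤ.* g 0
*ₛ-sucʳ f g n = cong₂ ℤ._+_
  (∑<-cong (suc n) λ { k (s≤s k≤n) → cong (λ j → f k ℤ.* g j) (ℕₚ.+-∸-assoc 1 k≤n) })
  (cong (λ j → f (suc n) ℤ.* g j) (ℕₚ.n∸n≡0 n))

*ₛ-coeff-cong : ∀ {f f′ g g′} n → (∀ k → k ≤ n → f k ≡ f′ k) → (∀ k → k ≤ n → g k ≡ g′ k) →
                (f *ₛ g) n ≡ (f′ *ₛ g′) n
*ₛ-coeff-cong n e e′ = ∑<-cong (suc n) λ { k (s≤s k≤n) →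
  cong₂ ℤ._*_ (e k k≤n) (e′ (n ∸ k) (ℕₚ.m∸n≤m n k)) }

*ₛ-coeff-comm : ∀ n f g → (f *ₛ g) n ≡ (g *ₛ f) n
*ₛ-coeff-comm zero    f g = cong (λ z → 0ℤ ℤ.+ z) (ℤₚ.*-comm (f 0) (g 0))
*ₛ-coeff-comm (suc n) f g = begin
  (f *ₛ g) (suc n)                                    ≡⟨ *ₛ-sucˡ f g n ⟩
  f 0 ℤ.* g (suc n) ℤ.+ ((f ∘ suc) *ₛ g) n            ≡⟨ cong₂ ℤ._+_ (ℤₚ.*-comm (f 0) (g (suc n))) (*ₛ-coeff-comm n (f ∘ suc) g) ⟩
  g (suc n) ℤ.* f 0 ℤ.+ (g *ₛ (f ∘ suc)) n            ≡⟨ ℤₚ.+-comm (g (suc n) ℤ.* f 0) _ ⟩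
  (g *ₛ (f ∘ suc)) n ℤ.+ g (suc n) ℤ.* f 0            ≡⟨ *ₛ-sucʳ g f n ⟨
  (g *ₛ f) (suc n)                                    ∎
  where open ≡-Reasoning

*ₛ-coeff-distribʳ : ∀ n h f g → ((f +ₛ g) *ₛ h) n ≡ (f *ₛ h) n ℤ.+ (g *ₛ h) n
*ₛ-coeff-distribʳ zero h f g =
  solve 3 (λ a b c → con 0ℤ :+ (a :+ b) :* c := (con 0ℤ :+ a :* c) :+ (con 0ℤ :+ b :* c)) refl (f 0) (g 0) (h 0)
  where open +-*-Solver
*ₛ-coeff-distribʳ (suc n) h f g = begin
  ((f +ₛ g) *ₛ h) (suc n)
    ≡⟨ *ₛ-sucˡ (f +ₛ g) h n ⟩
  (f 0 ℤ.+ g 0) ℤ.* h (suc n) ℤ.+ (((f ∘ suc) +ₛ (g ∘ suc)) *ₛ h) n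
    ≡⟨ cong (λ z → (f 0 ℤ.+ g 0) ℤ.* h (suc n) ℤ.+ z) (*ₛ-coeff-distribʳ n h (f ∘ suc) (g ∘ suc)) ⟩
  (f 0 ℤ.+ g 0) ℤ.* h (suc n) ℤ.+ (((f ∘ suc) *ₛ h) n ℤ.+ ((g ∘ suc) *ₛ h) n)
    ≡⟨ solve 5 (λ a b c s t → (a :+ b) :* c :+ (s :+ t) := (a :* c :+ s) :+ (b :* c :+ t)) refl
         (f 0) (g 0) (h (suc n)) (((f ∘ suc) *ₛ h) n) (((g ∘ suc) *ₛ h) n) ⟩
  (f 0 ℤ.* h (suc n) ℤ.+ ((f ∘ suc) *ₛ h) n) ℤ.+ (g 0 ℤ.* h (suc n) ℤ.+ ((g ∘ suc) *ₛ h) n)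
    ≡⟨ cong₂ ℤ._+_ (*ₛ-sucˡ f h n) (*ₛ-sucˡ g h n) ⟨
  (f *ₛ h) (suc n) ℤ.+ (g *ₛ h) (suc n) ∎
  where open ≡-Reasoning; open +-*-Solver

-- The shift of f g is f(0) g′ + f′ g, so the induction for associativity meets products whose first
-- factor is the scalar multiple f(0) g′.
scale : ℤ → Series → Series
scale c f n = c ℤ.* f n

*ₛ-coeff-scale : ∀ n c f g → (scale c f *ₛ g) n ≡ c ℤ.* (f *ₛ g) n
*ₛ-coeff-scale zero c f g =
  solve 3 (λ a b c → con 0ℤ :+ (a :* b) :* c := a :* (con 0ℤ :+ b :* c)) refl c (f 0) (g 0)
  where open +-*-Solver
*ₛ-coeff-scale (suc n) c f g = begin
  (scale c f *ₛ g) (suc n)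
    ≡⟨ *ₛ-sucˡ (scale c f) g n ⟩
  c ℤ.* f 0 ℤ.* g (suc n) ℤ.+ (scale c (f ∘ suc) *ₛ g) n
    ≡⟨ cong (λ z → c ℤ.* f 0 ℤ.* g (suc n) ℤ.+ z) (*ₛ-coeff-scale n c (f ∘ suc) g) ⟩
  c ℤ.* f 0 ℤ.* g (suc n) ℤ.+ c ℤ.* ((f ∘ suc) *ₛ g) n
    ≡⟨ solve 4 (λ a b d s → a :* b :* d :+ a :* s := a :* (b :* d :+ s)) refl
         c (f 0) (g (suc n)) (((f ∘ suc) *ₛ g) n) ⟩
  c ℤ.* (f 0 ℤ.* g (suc n) ℤ.+ ((f ∘ suc) *ₛ g) n)
    ≡⟨ cong (c ℤ.*_) (*ₛ-sucˡ f g n) ⟨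
  c ℤ.* (f *ₛ g) (suc n) ∎
  where open ≡-Reasoning; open +-*-Solver

*ₛ-coeff-assoc : ∀ n f g h → ((f *ₛ g) *ₛ h) n ≡ (f *ₛ (g *ₛ h)) n
*ₛ-coeff-assoc zero f g h =
  solve 3 (λ a b c → con 0ℤ :+ (con 0ℤ :+ a :* b) :* c := con 0ℤ :+ a :* (con 0ℤ :+ b :* c)) refl (f 0) (g 0) (h 0)
  where open +-*-Solver
*ₛ-coeff-assoc (suc n) f g h = begin
  ((f *ₛ g) *ₛ h) (suc n)
    ≡⟨ *ₛ-sucˡ (f *ₛ g) h n ⟩
  (f *ₛ g) 0 ℤ.* h (suc n) ℤ.+ (((f *ₛ g) ∘ suc) *ₛ h) n
    ≡⟨ cong (λ z → (f *ₛ g) 0 ℤ.* h (suc n) ℤ.+ z) (*ₛ-coeff-cong {g = h} n (λ k _ → *ₛ-sucˡ f g k) (λ _ _ → refl)) ⟩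
  (f *ₛ g) 0 ℤ.* h (suc n) ℤ.+ ((scale (f 0) (g ∘ suc) +ₛ (f ∘ suc) *ₛ g) *ₛ h) n
    ≡⟨ cong (λ z → (f *ₛ g) 0 ℤ.* h (suc n) ℤ.+ z) (*ₛ-coeff-distribʳ n h (scale (f 0) (g ∘ suc)) ((f ∘ suc) *ₛ g)) ⟩
  (f *ₛ g) 0 ℤ.* h (suc n) ℤ.+ ((scale (f 0) (g ∘ suc) *ₛ h) n ℤ.+ (((f ∘ suc) *ₛ g) *ₛ h) n)
    ≡⟨ cong (λ z → (f *ₛ g) 0 ℤ.* h (suc n) ℤ.+ z)
         (cong₂ ℤ._+_ (*ₛ-coeff-scale n (f 0) (g ∘ suc) h) (*ₛ-coeff-assoc n (f ∘ suc) g h)) ⟩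
  (f *ₛ g) 0 ℤ.* h (suc n) ℤ.+ (f 0 ℤ.* ((g ∘ suc) *ₛ h) n ℤ.+ ((f ∘ suc) *ₛ (g *ₛ h)) n)
    ≡⟨ solve 5 (λ a b c s t → (con 0ℤ :+ a :* b) :* c :+ (a :* s :+ t) := a :* (b :* c :+ s) :+ t) refl
         (f 0) (g 0) (h (suc n)) (((g ∘ suc) *ₛ h) n) (((f ∘ suc) *ₛ (g *ₛ h)) n) ⟩
  f 0 ℤ.* (g 0 ℤ.* h (suc n) ℤ.+ ((g ∘ suc) *ₛ h) n) ℤ.+ ((f ∘ suc) *ₛ (g *ₛ h)) n
    ≡⟨ cong (λ z → f 0 ℤ.* z ℤ.+ ((f ∘ suc) *ₛ (g *ₛ h)) n) (*ₛ-sucˡ g h n) ⟨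
  f 0 ℤ.* (g *ₛ h) (suc n) ℤ.+ ((f ∘ suc) *ₛ (g *ₛ h)) n
    ≡⟨ *ₛ-sucˡ f (g *ₛ h) n ⟨
  (f *ₛ (g *ₛ h)) (suc n) ∎
  where open ≡-Reasoning; open +-*-Solver


-- Opaque copies of the operations on series, because Agda would otherwise
-- η-expand series and compare them coefficientwise.
infixl 6 _+_ _-_
infixl 7 _*_ _/_
infix  8 -_
infixr 9 _^_

opaque

  _+_ _*_ : Series → Series → Series
  _+_ = _+ₛ_
  _*_ = _*ₛ_

  -_ : Series → Series
  -_ = -ₛ_

  +-defn : ∀ f g → f + g ≋ f +ₛ g
  +-defn f g = coeffs λ _ → refl

  neg-defn : ∀ f → - f ≋ -ₛ f
  neg-defn f = coeffs λ _ → refl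

  *-defn : ∀ f g → f * g ≋ f *ₛ g
  *-defn f g = coeffs λ _ → refl

  +-coeff : ∀ f g n → (f + g) n ≡ f n ℤ.+ g n
  +-coeff f g n = refl

  neg-coeff : ∀ f n → (- f) n ≡ ℤ.- f n
  neg-coeff f n = refl

  +-*-isCommutativeRing : IsCommutativeRing _≋_ _+_ _*_ -_ 0ₛ 1ₛ
  +-*-isCommutativeRing = record
    { isRing = record
      { +-isAbelianGroup = record
        { isGroup = record
          { isMonoid = record
            { isSemigroup = record
              { isMagma = record
                { isEquivalence = record
                  { refl  = coeffs λ _ → refl
                  ; sym   = λ e → coeffs λ n → sym (coeff e n)
                  ; trans = λ e e′ → coeffs λ n → trans (coeff e n) (coeff e′ n) }
                ; ∙-cong = λ e e′ → coeffs λ n → cong₂ ℤ._+_ (coeff e n) (coeff e′ n) }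
              ; assoc = λ f g h → coeffs λ n → ℤₚ.+-assoc (f n) (g n) (h n) }
            ; identity = (λ f → coeffs λ n → trans (cong (ℤ._+ f n) (0ₛ-coeff n)) (ℤₚ.+-identityˡ (f n)))
                       , (λ f → coeffs λ n → trans (cong (λ z → f n ℤ.+ z) (0ₛ-coeff n)) (ℤₚ.+-identityʳ (f n))) }
          ; inverse = (λ f → coeffs λ n → trans (ℤₚ.+-inverseˡ (f n)) (sym (0ₛ-coeff n)))
                    , (λ f → coeffs λ n → trans (ℤₚ.+-inverseʳ (f n)) (sym (0ₛ-coeff n)))
          ; ⁻¹-cong = λ e → coeffs λ n → cong ℤ.-_ (coeff e n) }
        ; comm = λ f g → coeffs λ n → ℤₚ.+-comm (f n) (g n) }
      ; *-cong = λ e e′ → coeffs λ n → *ₛ-coeff-cong n (λ k _ → coeff e k) (λ k _ → coeff e′ k)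
      ; *-assoc = λ f g h → coeffs λ n → *ₛ-coeff-assoc n f g h
      ; *-identity = (λ f → coeffs λ n → trans (*ₛ-coeff-comm n 1ₛ f) (*ₛ-identityʳ f n))
                   , (λ f → coeffs (*ₛ-identityʳ f))
      ; distrib = (λ f g h → coeffs λ n → trans (*ₛ-coeff-comm n f (g +ₛ h))
                     (trans (*ₛ-coeff-distribʳ n f g h)
                            (cong₂ ℤ._+_ (*ₛ-coeff-comm n g f) (*ₛ-coeff-comm n h f))))
                , (λ h f g → coeffs λ n → *ₛ-coeff-distribʳ n h f g) }
    ; *-comm = λ f g → coeffs λ n → *ₛ-coeff-comm n f g }

  const-+ : ∀ c d → const (c ℤ.+ d) ≋ const c + const d
  const-+ c d = coeffs λ { zero → refl ; (suc n) → refl }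

  const-neg : ∀ c → const (ℤ.- c) ≋ - const c
  const-neg c = coeffs λ { zero → refl ; (suc n) → refl }

  const-* : ∀ c d → const (c ℤ.* d) ≋ const c * const d
  const-* c d = coeffs λ
    { zero    → sym (ℤₚ.+-identityˡ (c ℤ.* d))
    ; (suc n) → sym (trans (*ₛ-sucˡ (const c) (const d) n)
        (cong₂ ℤ._+_ (ℤₚ.*-zeroʳ c) (∑<-zero (suc n) λ _ _ → refl))) }

  *-inverseʳ : ∀ g → g 0 ≡ 1ℤ → g * inverse g ≋ 1ₛ
  *-inverseʳ g g0 = coeffs (*ₛ-inverseʳ g g0)

  *-vanishesˡ : ∀ {n} f g → Vanishes n f → Vanishes n (f * g)
  *-vanishesˡ = *ₛ-vanishesˡ

  *-vanishesʳ : ∀ {n} f g → Vanishes n g → Vanishes n (f * g)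
  *-vanishesʳ = *ₛ-vanishesʳ

seriesRing : CommutativeRing 0ℓ 0ℓ
seriesRing = record { isCommutativeRing = +-*-isCommutativeRing }

open CommutativeRing seriesRing
  using (+-cong; *-cong; *-congˡ; *-congʳ; *-assoc; *-comm; *-identityˡ; *-identityʳ; zeroʳ; setoid)
  renaming (refl to ≋-refl; sym to ≋-sym; trans to ≋-trans; -‿cong to neg-cong)

module ≋-Reasoning where
  open import Relation.Binary.Reasoning.Setoid setoid public

-- Integers serve as the solver's coefficients, so that it computes with numerals inside identities
-- of series.
constMorphism : CommutativeRing.rawRing ℤₚ.+-*-commutativeRing -Raw-AlmostCommutative⟶ fromCommutativeRing seriesRing
constMorphism = record
  { ⟦_⟧    = const
  ; +-homo = const-+
  ; *-homo = const-*
  ; -‿homo = const-neg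
  ; 0-homo = ≋-refl
  ; 1-homo = ≋-refl
  }

const-≟ : ∀ c d → Maybe (const c ≋ const d)
const-≟ c d with c ℤ.≟ d
... | yes refl = just ≋-refl
... | no  _    = nothing

module SeriesSolver = Algebra.Solver.Ring _ (fromCommutativeRing seriesRing) constMorphism const-≟

_-_ _/_ : Series → Series → Series
f - g = f + (- g)
f / g = f * inverse g

_^_ : Series → ℕ → Series
f ^ zero  = 1ₛ
f ^ suc n = f ^ n * f

pochhammer : Series → Series → ℕ → Series
pochhammer a b zero    = 1ₛ
pochhammer a b (suc n) = pochhammer a b n * (1ₛ - a * b ^ n)

∑ : (ℕ → Series) → ℕ → Series
∑ t zero    = 0ₛ
∑ t (suc n) = ∑ t n + t n

^-defn : ∀ f n → f ^ n ≋ f ^ₛ n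
^-defn f zero    = ≋-refl
^-defn f (suc n) = ≋-trans (*-congʳ (^-defn f n)) (*-defn (f ^ₛ n) f)

^-cong : ∀ {f g} n → f ≋ g → f ^ n ≋ g ^ n
^-cong zero    e = ≋-refl
^-cong (suc n) e = *-cong (^-cong n e) e

pochhammer-cong : ∀ {a a′ b b′} n → a ≋ a′ → b ≋ b′ → pochhammer a b n ≋ pochhammer a′ b′ n
pochhammer-cong zero    e e′ = ≋-refl
pochhammer-cong (suc n) e e′ =
  *-cong (pochhammer-cong n e e′) (+-cong ≋-refl (neg-cong (*-cong e (^-cong n e′))))

pochhammer-defn : ∀ a b n → pochhammer a b n ≋ poch a b n
pochhammer-defn a b zero    = ≋-refl
pochhammer-defn a b (suc n) = begin
  pochhammer a b n * (1ₛ - a * b ^ n)  ≈⟨ *-cong (pochhammer-defn a b n) (+-cong ≋-refl (neg-cong (*-congˡ (^-defn b n)))) ⟩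
  poch a b n * (1ₛ - a * b ^ₛ n)       ≈⟨ *-congˡ (-*-defn 1ₛ a (b ^ₛ n)) ⟩
  poch a b n * (1ₛ -ₛ a *ₛ b ^ₛ n)     ≈⟨ *-defn (poch a b n) (1ₛ -ₛ a *ₛ b ^ₛ n) ⟩
  poch a b n *ₛ (1ₛ -ₛ a *ₛ b ^ₛ n)    ∎
  where
  open ≋-Reasoning
  opaque
    unfolding _+_
    -*-defn : ∀ f g h → f - g * h ≋ f -ₛ g *ₛ h
    -*-defn f g h = ≋-refl

∑-defn : ∀ t n → ∑ t n ≋ partialSums t n
∑-defn t n = coeffs λ k → go n k
  where
  go : ∀ n k → ∑ t n k ≡ partialSums t n k
  go zero    k = 0ₛ-coeff k
  go (suc n) k = trans (+-coeff (∑ t n) (t n) k) (cong (ℤ._+ t n k) (go n k))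

-- Powers, q-shifted factorials and sums

^-vanishes : ∀ f → f 0 ≡ 0ℤ → ∀ n → Vanishes n (f ^ n)
^-vanishes f f0 n k k<n = trans (coeff (^-defn f n) k) (^ₛ-vanishes f f0 n k k<n)

^-+ : ∀ f m n → f ^ (m ℕ.+ n) ≋ f ^ m * f ^ n
^-+ f zero    n = ≋-sym (*-identityˡ (f ^ n))
^-+ f (suc m) n = ≋-trans (*-congʳ (^-+ f m n))
  (solve 3 (λ a b c → a :* b :* c := a :* c :* b) ≋-refl (f ^ m) (f ^ n) f)
  where open SeriesSolver

^-assoc : ∀ f m n → f ^ (n ℕ.* m) ≋ (f ^ m) ^ n
^-assoc f m zero    = ≋-refl
^-assoc f m (suc n) = ≋-trans (^-+ f m (n ℕ.* m))
  (≋-trans (*-comm (f ^ m) (f ^ (n ℕ.* m))) (*-congʳ (^-assoc f m n)))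

^-distrib-* : ∀ f g n → (f * g) ^ n ≋ f ^ n * g ^ n
^-distrib-* f g zero    = ≋-sym (*-identityˡ 1ₛ)
^-distrib-* f g (suc n) = ≋-trans (*-congʳ (^-distrib-* f g n))
  (solve 4 (λ a b c d → a :* b :* (c :* d) := a :* c :* (b :* d)) ≋-refl (f ^ n) (g ^ n) f g)
  where open SeriesSolver

^-suc-square : ∀ f n → f ^ (suc n ℕ.* suc n) ≋ f ^ (n ℕ.* n) * (f ^ n * f ^ n) * f
^-suc-square f n = begin
  f ^ (n ℕ.+ n ℕ.* suc n) * f                  ≡⟨ cong (λ k → f ^ (n ℕ.+ k) * f) (ℕₚ.*-suc n n) ⟩
  f ^ (n ℕ.+ (n ℕ.+ n ℕ.* n)) * f              ≈⟨ *-congʳ (≋-trans (^-+ f n (n ℕ.+ n ℕ.* n)) (*-congˡ (^-+ f n (n ℕ.* n)))) ⟩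
  f ^ n * (f ^ n * f ^ (n ℕ.* n)) * f      ≈⟨ solve 3 (λ a b c → a :* (a :* b) :* c := b :* (a :* a) :* c) ≋-refl (f ^ n) (f ^ (n ℕ.* n)) f ⟩
  f ^ (n ℕ.* n) * (f ^ n * f ^ n) * f      ∎
  where open ≋-Reasoning; open SeriesSolver

-- Factor by factor, (1 - aB)(1 + aB) = 1 - a²B². This is the passage from base q² to base q⁴.
pochhammer-conjugate : ∀ a b n → pochhammer a b n * pochhammer (- a) b n ≋ pochhammer (a ^ 2) (b ^ 2) n
pochhammer-conjugate a b zero    = *-identityˡ 1ₛ
pochhammer-conjugate a b (suc n) = begin
  pochhammer a b n * (1ₛ - a * b ^ n) * (pochhammer (- a) b n * (1ₛ - (- a) * b ^ n))
    ≈⟨ solve 4 (λ p p′ a B → p :* (con 1ℤ :- a :* B) :* (p′ :* (con 1ℤ :- (:- a) :* B))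
                          := p :* p′ :* (con 1ℤ :- con 1ℤ :* a :* a :* (B :* B)))
         ≋-refl (pochhammer a b n) (pochhammer (- a) b n) a (b ^ n) ⟩
  pochhammer a b n * pochhammer (- a) b n * (1ₛ - a ^ 2 * (b ^ n * b ^ n))
    ≈⟨ *-cong (pochhammer-conjugate a b n) (+-cong ≋-refl (neg-cong (*-congˡ (≋-sym square)))) ⟩
  pochhammer (a ^ 2) (b ^ 2) n * (1ₛ - a ^ 2 * (b ^ 2) ^ n) ∎
  where
  open ≋-Reasoning
  open SeriesSolver
  square : (b ^ 2) ^ n ≋ b ^ n * b ^ n
  square = ≋-trans (^-cong n (*-congʳ (*-identityˡ b))) (^-distrib-* b b n)

∑-cong : ∀ {t u} n → (∀ k → k < n → t k ≋ u k) → ∑ t n ≋ ∑ u n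
∑-cong zero    e = ≋-refl
∑-cong (suc n) e = +-cong (∑-cong n λ k k<n → e k (ℕₚ.m<n⇒m<1+n k<n)) (e n ℕₚ.≤-refl)

*-distrib-∑ : ∀ f t n → ∑ (λ k → f * t k) n ≋ f * ∑ t n
*-distrib-∑ f t zero    = ≋-sym (zeroʳ f)
*-distrib-∑ f t (suc n) = ≋-trans (+-cong (*-distrib-∑ f t n) ≋-refl)
  (solve 3 (λ f s t → f :* s :+ f :* t := f :* (s :+ t)) ≋-refl f (∑ t n) (t n))
  where open SeriesSolver

-- Congruence modulo a power of q

infix 4 _≋[_]_
record _≋[_]_ (f : Series) (N : ℕ) (g : Series) : Set where
  constructor coeffs<
  field coeff< : ∀ n → n < N → f n ≡ g n
open _≋[_]_

mod-setoid : ℕ → Setoid 0ℓ 0ℓ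
mod-setoid N = record
  { Carrier = Series ; _≈_ = _≋[ N ]_
  ; isEquivalence = record
    { refl  = coeffs< λ _ _ → refl
    ; sym   = λ e → coeffs< λ n n<N → sym (coeff< e n n<N)
    ; trans = λ e e′ → coeffs< λ n n<N → trans (coeff< e n n<N) (coeff< e′ n n<N) } }

module mod-Reasoning (N : ℕ) where
  open import Relation.Binary.Reasoning.Setoid (mod-setoid N) public

module _ {N : ℕ} where

  open Setoid (mod-setoid N) public using ()
    renaming (refl to mod-refl; sym to mod-sym; trans to mod-trans)

  mod-fromExact : ∀ {f g} → f ≋ g → f ≋[ N ] g
  mod-fromExact e = coeffs< λ n _ → coeff e n

  opaque
    unfolding _+_

    mod-+-cong : ∀ {f f′ g g′} → f ≋[ N ] f′ → g ≋[ N ] g′ → f + g ≋[ N ] f′ + g′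
    mod-+-cong e e′ = coeffs< λ n n<N → cong₂ ℤ._+_ (coeff< e n n<N) (coeff< e′ n n<N)

    mod-*-cong : ∀ {f f′ g g′} → f ≋[ N ] f′ → g ≋[ N ] g′ → f * g ≋[ N ] f′ * g′
    mod-*-cong e e′ = coeffs< λ n n<N → *ₛ-coeff-cong n
      (λ k k≤n → coeff< e k (ℕₚ.≤-<-trans k≤n n<N))
      (λ k k≤n → coeff< e′ k (ℕₚ.≤-<-trans k≤n n<N))

  mod-*-cancelʳ : ∀ {f g} u → u 0 ≡ 1ℤ → f * u ≋[ N ] g * u → f ≋[ N ] g
  mod-*-cancelʳ {f} {g} u u0 e =
    mod-trans (mod-sym (mod-fromExact (undo f))) (mod-trans (mod-*-cong e mod-refl) (mod-fromExact (undo g)))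
    where
    undo : ∀ h → h * u * inverse u ≋ h
    undo h = ≋-trans (*-assoc h u (inverse u))
      (≋-trans (*-congˡ (*-inverseʳ u u0)) (*-identityʳ h))

*-cancelʳ : ∀ {f g} u → u 0 ≡ 1ℤ → f * u ≋ g * u → f ≋ g
*-cancelʳ u u0 e = coeffs λ n →
  coeff< (mod-*-cancelʳ {suc n} u u0 (mod-fromExact e)) n ℕₚ.≤-refl

/-* : ∀ f g → g 0 ≡ 1ℤ → f / g * g ≋ f
/-* f g g0 = begin
  f * inverse g * g    ≈⟨ solve 3 (λ f i g → f :* i :* g := f :* (g :* i)) ≋-refl f (inverse g) g ⟩
  f * (g * inverse g)  ≈⟨ *-congˡ (*-inverseʳ g g0) ⟩
  f * 1ₛ                ≈⟨ *-identityʳ f ⟩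
  f                      ∎
  where open ≋-Reasoning; open SeriesSolver

pochhammer-constant : ∀ a b → a 0 ≡ 0ℤ → ∀ n → pochhammer a b n 0 ≡ 1ℤ
pochhammer-constant a b a0 n = trans (coeff (pochhammer-defn a b n) 0) (poch-constant a b a0 n)

poch∞-mod : ∀ {a a′ b b′} b0 N → a ≋ a′ → b ≋ b′ → poch∞ a′ b′ b0 ≋[ N ] pochhammer a b N
poch∞-mod {a′ = a} {b′ = b} b0 N e e′ = mod-trans
  -- The stabilisation index in degree n is n + 1, so `n<N` is literally the bound it asks for.
  (coeffs< λ n n<N → sym (proj₂ (poch-converges a b b0 n) N n<N))
  (mod-sym (mod-fromExact (≋-trans (pochhammer-cong N e e′) (pochhammer-defn a b N))))

∑∞-mod : ∀ t v N → ∑∞ t (∑-converges t v) ≋[ N ] ∑ t N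
∑∞-mod t v N = mod-trans
  (coeffs< λ n n<N → sym (proj₂ (∑-converges t v n) N n<N))
  (mod-sym (mod-fromExact (∑-defn t N)))

-- The substitution q ↦ -q

∑<-*ˡ : ∀ c f n → c ℤ.* ∑< n f ≡ ∑< n (λ k → c ℤ.* f k)
∑<-*ˡ c f zero    = ℤₚ.*-zeroʳ c
∑<-*ˡ c f (suc n) = trans (ℤₚ.*-distribˡ-+ c (∑< n f) (f n)) (cong (ℤ._+ c ℤ.* f n) (∑<-*ˡ c f n))

infix 10 _⟨-q⟩

opaque
  unfolding _+_

  _⟨-q⟩ : Series → Series
  _⟨-q⟩ = _[-q]

  ⟨-q⟩-defn : ∀ f → f ⟨-q⟩ ≋ f [-q]
  ⟨-q⟩-defn f = ≋-refl

  ⟨-q⟩-cong : ∀ {f g} → f ≋ g → f ⟨-q⟩ ≋ g ⟨-q⟩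
  ⟨-q⟩-cong e = coeffs λ n → cong ((-1ℤ ℤ.^ n) ℤ.*_) (coeff e n)

  ⟨-q⟩-* : ∀ f g → (f * g) ⟨-q⟩ ≋ f ⟨-q⟩ * g ⟨-q⟩
  ⟨-q⟩-* f g = coeffs λ n → trans
    (∑<-*ˡ (-1ℤ ℤ.^ n) (λ k → f k ℤ.* g (n ∸ k)) (suc n))
    (∑<-cong (suc n) λ { k (s≤s k≤n) → begin
      (-1ℤ ℤ.^ n) ℤ.* (f k ℤ.* g (n ∸ k))
        ≡⟨ cong (λ j → (-1ℤ ℤ.^ j) ℤ.* (f k ℤ.* g (n ∸ k))) (ℕₚ.m+[n∸m]≡n k≤n) ⟨
      (-1ℤ ℤ.^ (k ℕ.+ (n ∸ k))) ℤ.* (f k ℤ.* g (n ∸ k))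
        ≡⟨ cong (ℤ._* (f k ℤ.* g (n ∸ k))) (ℤₚ.^-distribˡ-+-* -1ℤ k (n ∸ k)) ⟩
      (-1ℤ ℤ.^ k) ℤ.* (-1ℤ ℤ.^ (n ∸ k)) ℤ.* (f k ℤ.* g (n ∸ k))
        ≡⟨ solve 4 (λ a b c d → a :* b :* (c :* d) := a :* c :* (b :* d)) refl
             (-1ℤ ℤ.^ k) (-1ℤ ℤ.^ (n ∸ k)) (f k) (g (n ∸ k)) ⟩
      (-1ℤ ℤ.^ k) ℤ.* f k ℤ.* ((-1ℤ ℤ.^ (n ∸ k)) ℤ.* g (n ∸ k)) ∎ })
    where
    open ≡-Reasoning
    open +-*-Solver

  ⟨-q⟩-const : ∀ c → const c ⟨-q⟩ ≋ const c
  ⟨-q⟩-const c = coeffs λ { zero → ℤₚ.*-identityˡ c ; (suc n) → ℤₚ.*-zeroʳ (-1ℤ ℤ.^ suc n) }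

  ⟨-q⟩-neg : ∀ f → (- f) ⟨-q⟩ ≋ - (f ⟨-q⟩)
  ⟨-q⟩-neg f = coeffs λ n → sym (ℤₚ.neg-distribʳ-* (-1ℤ ℤ.^ n) (f n))

  ⟨-q⟩-+ : ∀ f g → (f + g) ⟨-q⟩ ≋ f ⟨-q⟩ + g ⟨-q⟩
  ⟨-q⟩-+ f g = coeffs λ n → ℤₚ.*-distribˡ-+ (-1ℤ ℤ.^ n) (f n) (g n)

  ⟨-q⟩-q : q ⟨-q⟩ ≋ - q
  ⟨-q⟩-q = coeffs λ { 0 → refl ; 1 → refl ; (suc (suc n)) → ℤₚ.*-zeroʳ (-1ℤ ℤ.^ suc (suc n)) }

  mod-⟨-q⟩ : ∀ {N f g} → f ≋[ N ] g → f ⟨-q⟩ ≋[ N ] g ⟨-q⟩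
  mod-⟨-q⟩ e = coeffs< λ n n<N → cong ((-1ℤ ℤ.^ n) ℤ.*_) (coeff< e n n<N)

⟨-q⟩-^ : ∀ f n → (f ^ n) ⟨-q⟩ ≋ (f ⟨-q⟩) ^ n
⟨-q⟩-^ f zero    = ⟨-q⟩-const 1ℤ
⟨-q⟩-^ f (suc n) = ≋-trans (⟨-q⟩-* (f ^ n) f) (*-congʳ (⟨-q⟩-^ f n))

⟨-q⟩-pochhammer : ∀ a b n → pochhammer a b n ⟨-q⟩ ≋ pochhammer (a ⟨-q⟩) (b ⟨-q⟩) n
⟨-q⟩-pochhammer a b zero    = ⟨-q⟩-const 1ℤ
⟨-q⟩-pochhammer a b (suc n) = ≋-trans (⟨-q⟩-* (pochhammer a b n) (1ₛ - a * b ^ n)) (*-cong (⟨-q⟩-pochhammer a b n)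
  (≋-trans (⟨-q⟩-+ 1ₛ (- (a * b ^ n))) (+-cong (⟨-q⟩-const 1ℤ)
    (≋-trans (⟨-q⟩-neg (a * b ^ n))
      (neg-cong (≋-trans (⟨-q⟩-* a (b ^ n)) (*-congˡ (⟨-q⟩-^ b n))))))))

⟨-q⟩-∑ : ∀ t n → ∑ t n ⟨-q⟩ ≋ ∑ (λ k → t k ⟨-q⟩) n
⟨-q⟩-∑ t zero    = ⟨-q⟩-const 0ℤ
⟨-q⟩-∑ t (suc n) = ≋-trans (⟨-q⟩-+ (∑ t n) (t n)) (+-cong (⟨-q⟩-∑ t n) ≋-refl)

-- The signs cancel because n² and n have the same parity.
⟨-q⟩-signed-square : ∀ n → ((- 1ₛ) ^ n * q ^ (n ℕ.* n)) ⟨-q⟩ ≋ q ^ (n ℕ.* n)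
⟨-q⟩-signed-square n = begin
  ((- 1ₛ) ^ n * q ^ (n ℕ.* n)) ⟨-q⟩
    ≈⟨ ⟨-q⟩-* ((- 1ₛ) ^ n) (q ^ (n ℕ.* n)) ⟩
  ((- 1ₛ) ^ n) ⟨-q⟩ * (q ^ (n ℕ.* n)) ⟨-q⟩
    ≈⟨ *-cong (≋-trans (⟨-q⟩-^ (- 1ₛ) n) (^-cong n (≋-trans (⟨-q⟩-neg 1ₛ) (neg-cong (⟨-q⟩-const 1ℤ)))))
              (≋-trans (⟨-q⟩-^ q (n ℕ.* n)) (^-cong (n ℕ.* n) ⟨-q⟩-q)) ⟩
  (- 1ₛ) ^ n * (- q) ^ (n ℕ.* n)
    ≈⟨ cancelSigns n ⟩
  q ^ (n ℕ.* n) ∎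
  where
  open ≋-Reasoning
  open SeriesSolver
  even-power : ∀ n → (- q) ^ n * (- q) ^ n ≋ q ^ n * q ^ n
  even-power zero    = ≋-refl
  even-power (suc n) = begin
    (- q) ^ n * (- q) * ((- q) ^ n * (- q))
      ≈⟨ solve 2 (λ a b → a :* (:- b) :* (a :* (:- b)) := a :* a :* (b :* b)) ≋-refl ((- q) ^ n) q ⟩
    (- q) ^ n * (- q) ^ n * (q * q)
      ≈⟨ *-congʳ (even-power n) ⟩
    q ^ n * q ^ n * (q * q)
      ≈⟨ solve 2 (λ a b → a :* a :* (b :* b) := a :* b :* (a :* b)) ≋-refl (q ^ n) q ⟩
    q ^ n * q * (q ^ n * q) ∎

  -- By (n + 1)² = n² + 2n + 1: the even exponent 2n carries no sign, and the sign of the last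
  -- factor -q cancels the new -1.
  cancelSigns : ∀ n → (- 1ₛ) ^ n * (- q) ^ (n ℕ.* n) ≋ q ^ (n ℕ.* n)
  cancelSigns zero    = *-identityˡ 1ₛ
  cancelSigns (suc n) = begin
    (- 1ₛ) ^ n * (- 1ₛ) * (- q) ^ (suc n ℕ.* suc n)
      ≈⟨ *-congˡ (^-suc-square (- q) n) ⟩
    (- 1ₛ) ^ n * (- 1ₛ) * ((- q) ^ (n ℕ.* n) * ((- q) ^ n * (- q) ^ n) * (- q))
      ≈⟨ solve 4 (λ a b c q → a :* (:- con 1ℤ) :* (b :* c :* (:- q)) := a :* b :* c :* q) ≋-refl
           ((- 1ₛ) ^ n) ((- q) ^ (n ℕ.* n)) ((- q) ^ n * (- q) ^ n) q ⟩
    (- 1ₛ) ^ n * (- q) ^ (n ℕ.* n) * ((- q) ^ n * (- q) ^ n) * q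
      ≈⟨ *-congʳ (*-cong (cancelSigns n) (even-power n)) ⟩
    q ^ (n ℕ.* n) * (q ^ n * q ^ n) * q
      ≈⟨ ^-suc-square q n ⟨
    q ^ (suc n ℕ.* suc n) ∎

σ*-term-* : ∀ n → σ*-term n * pochhammer q (q ^ 2) n ≋ (- 1ₛ) ^ n * q ^ (n ℕ.* n)
σ*-term-* n = begin
  σ*-term n * pochhammer q (q ^ 2) n
    ≈⟨ *-congˡ (≋-trans (pochhammer-cong n ≋-refl (^-defn q 2)) (pochhammer-defn q (q ^ₛ 2) n)) ⟩
  σ*-term n * p
    ≈⟨ *-congʳ (*-defn numerator (inverse p)) ⟨
  numerator / p * p
    ≈⟨ /-* numerator p (poch-constant q (q ^ₛ 2) refl n) ⟩
  (-ₛ 1ₛ) ^ₛ n *ₛ q ^ₛ (n ℕ.* n)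
    ≈⟨ *-defn ((-ₛ 1ₛ) ^ₛ n) (q ^ₛ (n ℕ.* n)) ⟨
  (-ₛ 1ₛ) ^ₛ n * q ^ₛ (n ℕ.* n)
    ≈⟨ *-cong (≋-trans (^-cong n (neg-defn 1ₛ)) (^-defn (-ₛ 1ₛ) n)) (^-defn q (n ℕ.* n)) ⟨
  (- 1ₛ) ^ n * q ^ (n ℕ.* n) ∎
  where
  open ≋-Reasoning
  p = poch q (q ^ₛ 2) n
  numerator = (-ₛ 1ₛ) ^ₛ n *ₛ q ^ₛ (n ℕ.* n)

-- The substitution fixes q² and turns (q;q²)_n into (-q;q²)_n. The denominator stays on the left
-- because `pod-odd-staircase` carries the same product there.
σ*-term-⟨-q⟩ : ∀ n → σ*-term n ⟨-q⟩ * pochhammer (- q) (q ^ 2) n ≋ q ^ (n ℕ.* n)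
σ*-term-⟨-q⟩ n = begin
  σ*-term n ⟨-q⟩ * pochhammer (- q) (q ^ 2) n
    ≈⟨ *-congˡ (≋-trans (⟨-q⟩-pochhammer q (q ^ 2) n) (pochhammer-cong n ⟨-q⟩-q q²⟨-q⟩)) ⟨
  σ*-term n ⟨-q⟩ * pochhammer q (q ^ 2) n ⟨-q⟩
    ≈⟨ ⟨-q⟩-* (σ*-term n) (pochhammer q (q ^ 2) n) ⟨
  (σ*-term n * pochhammer q (q ^ 2) n) ⟨-q⟩
    ≈⟨ ⟨-q⟩-cong (σ*-term-* n) ⟩
  ((- 1ₛ) ^ n * q ^ (n ℕ.* n)) ⟨-q⟩
    ≈⟨ ⟨-q⟩-signed-square n ⟩
  q ^ (n ℕ.* n) ∎
  where
  open ≋-Reasoning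
  open SeriesSolver
  q²⟨-q⟩ : (q ^ 2) ⟨-q⟩ ≋ q ^ 2
  q²⟨-q⟩ = ≋-trans (⟨-q⟩-^ q 2) (≋-trans (^-cong 2 ⟨-q⟩-q)
    (solve 1 (λ q → con 1ℤ :* (:- q) :* (:- q) := con 1ℤ :* q :* q) ≋-refl q))

-- Gauss's theorem on triangular numbers

module Shanks (x : Series) (x0 : x 0 ≡ 0ℤ) where

  open SeriesSolver

  x² : Series
  x² = x ^ 2

  x²0 : x² 0 ≡ 0ℤ
  x²0 = *-vanishesʳ {1} (1ₛ * x) x (λ { zero _ → x0 ; (suc _) (s≤s ()) }) 0 (s≤s z≤n)

  -- This is 1/R_s. The other factor R_N of Shanks's summands enters `finite-gauss` as the two
  -- products in front of the sums.
  ratio : ℕ → Series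
  ratio s = pochhammer x x² s / pochhammer x² x² s

  ratio-* : ∀ s → ratio s * pochhammer x² x² s ≋ pochhammer x x² s
  ratio-* s = /-* (pochhammer x x² s) (pochhammer x² x² s) (pochhammer-constant x² x² x²0 s)

  ratio-suc : ∀ s → ratio (suc s) * (1ₛ - x² * x² ^ s) ≋ ratio s * (1ₛ - x * x² ^ s)
  ratio-suc s = *-cancelʳ (pochhammer x² x² s) (pochhammer-constant x² x² x²0 s) (begin
    ratio (suc s) * ε * pochhammer x² x² s        ≈⟨ solve 3 (λ r e p → r :* e :* p := r :* (p :* e)) ≋-refl (ratio (suc s)) ε (pochhammer x² x² s) ⟩
    ratio (suc s) * (pochhammer x² x² s * ε)      ≈⟨ ratio-* (suc s) ⟩
    pochhammer x x² s * α                          ≈⟨ *-congʳ (ratio-* s) ⟨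
    ratio s * pochhammer x² x² s * α              ≈⟨ solve 3 (λ r p a → r :* p :* a := r :* a :* p) ≋-refl (ratio s) (pochhammer x² x² s) α ⟩
    ratio s * α * pochhammer x² x² s              ∎)
    where
    open ≋-Reasoning
    ε = 1ₛ - x² * x² ^ s
    α = 1ₛ - x * x² ^ s

  geometric : Series → ℕ → Series
  geometric y = ∑ (λ s → y ^ s * ratio s)

  -- For the full series F(y) = ∑ y^s (x;x²)_s/(x²;x²)_s this is (1 - xy) F(x²y) = (1 - y) F(y), the
  -- functional equation behind the q-binomial theorem. Term by term the two sides differ by
  -- consecutive values of y^s (1 - x^(2s)) `ratio s`, so truncation leaves one boundary term.
  telescope : ∀ y j → (1ₛ - x * y) * geometric (x² * y) j
                    ≋ (1ₛ - y) * geometric y j + y ^ j * (1ₛ - x² ^ j) * ratio j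
  telescope y zero = solve 3
    (λ x y r → (con 1ℤ :- x :* y) :* con 0ℤ
            := (con 1ℤ :- y) :* con 0ℤ :+ con 1ℤ :* (con 1ℤ :- con 1ℤ) :* r) ≋-refl x y (ratio 0)
  telescope y (suc j) = begin
    (1ₛ - x * y) * (A + (x² * y) ^ j * r)
      ≈⟨ *-congˡ (+-cong ≋-refl (*-congʳ (^-distrib-* x² y j))) ⟩
    (1ₛ - x * y) * (A + X * Y * r)
      ≈⟨ solve 6 (λ x y A X Y r → (con 1ℤ :- x :* y) :* (A :+ X :* Y :* r)
                               := (con 1ℤ :- x :* y) :* A :+ (con 1ℤ :- x :* y) :* (X :* Y :* r)) ≋-refl x y A X Y r ⟩
    (1ₛ - x * y) * A + (1ₛ - x * y) * (X * Y * r)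
      ≈⟨ +-cong (telescope y j) ≋-refl ⟩
    (1ₛ - y) * B + Y * (1ₛ - X) * r + (1ₛ - x * y) * (X * Y * r)
      ≈⟨ solve 6 (λ x y B X Y r → (con 1ℤ :- y) :* B :+ Y :* (con 1ℤ :- X) :* r :+ (con 1ℤ :- x :* y) :* (X :* Y :* r)
                               := (con 1ℤ :- y) :* (B :+ Y :* r) :+ Y :* y :* (r :* (con 1ℤ :- x :* X))) ≋-refl x y B X Y r ⟩
    (1ₛ - y) * (B + Y * r) + Y * y * (r * (1ₛ - x * X))
      ≈⟨ +-cong ≋-refl (*-congˡ (ratio-suc j)) ⟨
    (1ₛ - y) * (B + Y * r) + Y * y * (ratio (suc j) * (1ₛ - x² * X))
      ≈⟨ +-cong ≋-refl (solve 4 (λ Yy r′ x² X → Yy :* (r′ :* (con 1ℤ :- x² :* X)) := Yy :* (con 1ℤ :- X :* x²) :* r′)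
           ≋-refl (Y * y) (ratio (suc j)) x² X) ⟩
    (1ₛ - y) * (B + Y * r) + Y * y * (1ₛ - X * x²) * ratio (suc j) ∎
    where
    open ≋-Reasoning
    A = geometric (x² * y) j
    B = geometric y j
    X = x² ^ j
    Y = y ^ j
    r = ratio j

  oddPower : ℕ → Series
  oddPower N = x * x² ^ N

  -- x^T(2N) + x^T(2N+1) for the triangular numbers T(m) = m(m+1)/2
  trianglePair : ℕ → Series
  trianglePair N = oddPower N ^ N * (1ₛ + oddPower N)

  -- Passing from N to N + 1 multiplies the base x^(2N+1) of the geometric powers by x², exactly the
  -- shift that `telescope` undoes.
  finite-gauss : ∀ N → pochhammer x x² N * ∑ trianglePair N ≋ pochhammer x² x² N * geometric (oddPower N) N
  finite-gauss zero    = ≋-refl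
  finite-gauss (suc N) = ≋-sym (begin
    e * (1ₛ - x² * X) * geometric (oddPower (suc N)) (suc N)
      ≈⟨ *-congˡ (∑-cong (suc N) λ s _ → *-congʳ (^-cong s
           (solve 3 (λ x X x² → x :* (X :* x²) := x² :* (x :* X)) ≋-refl x X x²))) ⟩
    e * (1ₛ - x² * X) * (A + (x² * y) ^ N * r)
      ≈⟨ *-congˡ (+-cong ≋-refl (*-congʳ (^-distrib-* x² y N))) ⟩
    e * (1ₛ - x² * X) * (A + X * Y * r)
      ≈⟨ solve 6 (λ e x X A Y r → e :* (con 1ℤ :- con 1ℤ :* x :* x :* X) :* (A :+ X :* Y :* r)
                 := e :* ((con 1ℤ :- x :* (x :* X)) :* A) :+ e :* r :* ((con 1ℤ :- x :* x :* X) :* X :* Y))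
           ≋-refl e x X A Y r ⟩
    e * ((1ₛ - x * y) * A) + e * r * ((1ₛ - x * x * X) * X * Y)
      ≈⟨ +-cong (*-congˡ (telescope y N)) ≋-refl ⟩
    e * ((1ₛ - y) * B + Y * (1ₛ - X) * r) + e * r * ((1ₛ - x * x * X) * X * Y)
      -- With X = x^(2N) and y = xX, the boundary term and the last summand combine through (1 - X)
      -- + (1 - x²X) X = 1 - y² = (1 - y)(1 + y); the factor 1 + y completes the new `trianglePair`.
      ≈⟨ solve 6 (λ e x X B Y r → e :* ((con 1ℤ :- x :* X) :* B :+ Y :* (con 1ℤ :- X) :* r) :+ e :* r :* ((con 1ℤ :- x :* x :* X) :* X :* Y)
                 := e :* B :* (con 1ℤ :- x :* X) :+ r :* e :* (con 1ℤ :- x :* X) :* (Y :* (con 1ℤ :+ x :* X)))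
           ≋-refl e x X B Y r ⟩
    e * B * (1ₛ - y) + r * e * (1ₛ - y) * (Y * (1ₛ + y))
      ≈⟨ +-cong (*-congʳ (≋-sym (finite-gauss N))) (*-congʳ (*-congʳ (ratio-* N))) ⟩
    a * T * (1ₛ - y) + a * (1ₛ - y) * (Y * (1ₛ + y))
      ≈⟨ solve 4 (λ a T y Y → a :* T :* (con 1ℤ :- y) :+ a :* (con 1ℤ :- y) :* (Y :* (con 1ℤ :+ y))
                           := a :* (con 1ℤ :- y) :* (T :+ Y :* (con 1ℤ :+ y))) ≋-refl a T y Y ⟩
    a * (1ₛ - y) * (T + Y * (1ₛ + y)) ∎)
    where
    open ≋-Reasoning
    a = pochhammer x x² N
    e = pochhammer x² x² N
    X = x² ^ N
    y = oddPower N
    Y = y ^ N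
    A = geometric (x² * y) N
    B = geometric y N
    T = ∑ trianglePair N
    r = ratio N

  geometric-mod : ∀ N y n → Vanishes N y → geometric y (suc n) ≋[ N ] 1ₛ
  geometric-mod N y zero    v = mod-fromExact (begin
    0ₛ + 1ₛ * ratio 0   ≈⟨ solve 1 (λ r → con 0ℤ :+ con 1ℤ :* r := r :* con 1ℤ) ≋-refl (ratio 0) ⟩
    ratio 0 * 1ₛ         ≈⟨ ratio-* 0 ⟩
    1ₛ                    ∎)
    where open ≋-Reasoning
  geometric-mod N y (suc n) v = coeffs< λ k k<N → trans
    (+-coeff (geometric y (suc n)) (y ^ suc n * ratio (suc n)) k) (trans (cong₂ ℤ._+_ (coeff< (geometric-mod N y n v) k k<N)
      (*-vanishesˡ (y ^ suc n) (ratio (suc n)) (*-vanishesʳ (y ^ n) y v) k k<N))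
    (ℤₚ.+-identityʳ (1ₛ k)))

  gauss-mod : ∀ n → pochhammer x x² (suc n) * ∑ trianglePair (suc n) ≋[ suc n ] pochhammer x² x² (suc n)
  gauss-mod n = mod-trans (mod-fromExact (finite-gauss (suc n))) (mod-trans
    (mod-*-cong mod-refl (geometric-mod (suc n) (oddPower (suc n)) n
      (*-vanishesʳ x (x² ^ suc n) (^-vanishes x² x²0 (suc n)))))
    (mod-fromExact ((*-identityʳ (pochhammer x² x² (suc n))))))

module Triangular = Shanks (q ^ 2) (coeff (^-defn q 2) 0)

-- At x = q² the power y = q^(2(2N+1)) satisfies y^N = q^(2N(2N+1)) and y^(N+1) = q^((2N+1)(2N+2)),
-- two consecutive terms of the sum on the left.
∑-trianglePair : ∀ N → ∑ (λ m → q ^ (m ℕ.* suc m)) (N ℕ.* 2) ≋ ∑ Triangular.trianglePair N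
∑-trianglePair zero    = ≋-refl
∑-trianglePair (suc N) = begin
  S + q ^ (N ℕ.* 2 ℕ.* suc (N ℕ.* 2)) + q ^ (suc (N ℕ.* 2) ℕ.* suc (suc (N ℕ.* 2)))
    ≈⟨ +-cong (+-cong (∑-trianglePair N) (power N (N ℕ.* 2 ℕ.* suc (N ℕ.* 2)) even-exponent))
              (power (suc N) (suc (N ℕ.* 2) ℕ.* suc (suc (N ℕ.* 2))) odd-exponent) ⟩
  T + Y + Y * y
    ≈⟨ solve 3 (λ T Y y → T :+ Y :+ Y :* y := T :+ Y :* (con 1ℤ :+ y)) ≋-refl T Y y ⟩
  T + Y * (1ₛ + y) ∎
  where
  open ≋-Reasoning
  open SeriesSolver
  S = ∑ (λ m → q ^ (m ℕ.* suc m)) (N ℕ.* 2)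
  T = ∑ Triangular.trianglePair N
  y = Triangular.oddPower N
  Y = y ^ N

  odd-power : q ^ (suc (N ℕ.* 2) ℕ.* 2) ≋ y
  odd-power = ≋-trans (^-assoc q 2 (suc (N ℕ.* 2)))
    (≋-trans (*-comm ((q ^ 2) ^ (N ℕ.* 2)) (q ^ 2)) (*-congˡ (^-assoc (q ^ 2) 2 N)))

  power : ∀ s k → k ≡ s ℕ.* (suc (N ℕ.* 2) ℕ.* 2) → q ^ k ≋ y ^ s
  power s k refl = ≋-trans (^-assoc q (suc (N ℕ.* 2) ℕ.* 2) s) (^-cong s odd-power)

  even-exponent : N ℕ.* 2 ℕ.* suc (N ℕ.* 2) ≡ N ℕ.* (suc (N ℕ.* 2) ℕ.* 2)
  even-exponent = ℕ-Solver.solve 1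
    (λ n → n ℕ-Solver.:* ℕ-Solver.con 2 ℕ-Solver.:* (ℕ-Solver.con 1 ℕ-Solver.:+ n ℕ-Solver.:* ℕ-Solver.con 2)
      ℕ-Solver.:= n ℕ-Solver.:* ((ℕ-Solver.con 1 ℕ-Solver.:+ n ℕ-Solver.:* ℕ-Solver.con 2) ℕ-Solver.:* ℕ-Solver.con 2)) refl N

  odd-exponent : suc (N ℕ.* 2) ℕ.* suc (suc (N ℕ.* 2)) ≡ suc N ℕ.* (suc (N ℕ.* 2) ℕ.* 2)
  odd-exponent = trans (ℕₚ.*-comm (suc (N ℕ.* 2)) (suc N ℕ.* 2))
    (trans (ℕₚ.*-assoc (suc N) 2 (suc (N ℕ.* 2))) (cong (suc N ℕ.*_) (ℕₚ.*-comm 2 (suc (N ℕ.* 2)))))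

-- Weighted counts

indicator : ∀ {A : Set} → Dec A → ℤ
indicator (yes _) = 1ℤ
indicator (no  _) = 0ℤ

indicator-true : ∀ {A : Set} (a : Dec A) → A → indicator a ≡ 1ℤ
indicator-true (yes _) x = refl
indicator-true (no ¬x) x = contradiction x ¬x

indicator-false : ∀ {A : Set} (a : Dec A) → ¬ A → indicator a ≡ 0ℤ
indicator-false (yes x) ¬x = contradiction x ¬x
indicator-false (no _)  ¬x = refl

indicator-cong : ∀ {A B : Set} (a : Dec A) (b : Dec B) → (A → B) → (B → A) → indicator a ≡ indicator b
indicator-cong (yes x) b f g = sym (indicator-true b (f x))
indicator-cong (no ¬x) b f g = sym (indicator-false b (¬x ∘ g))

indicator-× : ∀ {A B : Set} (a : Dec A) (b : Dec B) → indicator (a ×-dec b) ≡ indicator a ℤ.* indicator b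
indicator-× (yes _) (yes _) = refl
indicator-× (yes _) (no _)  = refl
indicator-× (no _)  (yes _) = refl
indicator-× (no _)  (no _)  = refl

sumOver : ∀ {A : Set} → List A → (A → ℤ) → ℤ
sumOver []       w = 0ℤ
sumOver (x ∷ xs) w = w x ℤ.+ sumOver xs w

module _ {A : Set} where

  sumOver-cong : ∀ (xs : List A) {w v} → (∀ {x} → x ∈ xs → w x ≡ v x) → sumOver xs w ≡ sumOver xs v
  sumOver-cong []       e = refl
  sumOver-cong (x ∷ xs) e = cong₂ ℤ._+_ (e (here refl)) (sumOver-cong xs (e ∘ there))

  sumOver-0 : ∀ (xs : List A) → sumOver xs (λ _ → 0ℤ) ≡ 0ℤ
  sumOver-0 []       = refl
  sumOver-0 (x ∷ xs) = trans (ℤₚ.+-identityˡ _) (sumOver-0 xs)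

  sumOver-++ : ∀ (xs ys : List A) w → sumOver (xs ++ ys) w ≡ sumOver xs w ℤ.+ sumOver ys w
  sumOver-++ []       ys w = sym (ℤₚ.+-identityˡ (sumOver ys w))
  sumOver-++ (x ∷ xs) ys w = trans (cong (λ z → w x ℤ.+ z) (sumOver-++ xs ys w))
    (sym (ℤₚ.+-assoc (w x) (sumOver xs w) (sumOver ys w)))

  sumOver-map : ∀ {B : Set} (f : B → A) (xs : List B) w → sumOver (map f xs) w ≡ sumOver xs (w ∘ f)
  sumOver-map f []       w = refl
  sumOver-map f (x ∷ xs) w = cong (λ z → w (f x) ℤ.+ z) (sumOver-map f xs w)

  sumOver-+ : ∀ (xs : List A) w v → sumOver xs (λ x → w x ℤ.+ v x) ≡ sumOver xs w ℤ.+ sumOver xs v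
  sumOver-+ []       w v = refl
  sumOver-+ (x ∷ xs) w v = trans (cong (λ z → w x ℤ.+ v x ℤ.+ z) (sumOver-+ xs w v))
    (solve 4 (λ a b c d → a :+ b :+ (c :+ d) := a :+ c :+ (b :+ d)) refl (w x) (v x) (sumOver xs w) (sumOver xs v))
    where open +-*-Solver

  sumOver-* : ∀ (xs : List A) c w → sumOver xs (λ x → c ℤ.* w x) ≡ c ℤ.* sumOver xs w
  sumOver-* []       c w = sym (ℤₚ.*-zeroʳ c)
  sumOver-* (x ∷ xs) c w = trans (cong (λ z → c ℤ.* w x ℤ.+ z) (sumOver-* xs c w))
    (sym (ℤₚ.*-distribˡ-+ c (w x) (sumOver xs w)))

  sumOver-filter : ∀ {P : Pred A 0ℓ} (P? : Decidable P) (xs : List A) w →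
                   sumOver (filter P? xs) w ≡ sumOver xs (λ x → indicator (P? x) ℤ.* w x)
  sumOver-filter P? []       w = refl
  sumOver-filter P? (x ∷ xs) w with P? x
  ... | yes _ = cong₂ ℤ._+_ (sym (ℤₚ.*-identityˡ (w x))) (sumOver-filter P? xs w)
  ... | no  _ = trans (sumOver-filter P? xs w) (sym (ℤₚ.+-identityˡ _))

  sumOver-sum : ∀ (f : A → ℕ) xs → + sum (map f xs) ≡ sumOver xs (λ x → + f x)
  sumOver-sum f []       = refl
  sumOver-sum f (x ∷ xs) = cong (λ z → + f x ℤ.+ z) (sumOver-sum f xs)

  sumOver-length : ∀ (xs : List A) → + length xs ≡ sumOver xs (λ _ → 1ℤ)
  sumOver-length []       = refl
  sumOver-length (x ∷ xs) = cong (λ z → 1ℤ ℤ.+ z) (sumOver-length xs)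

-- Generating functions of weighted partitions with bounded parts

-- Arbitrary weights are allowed because removing a largest part k + 1 turns w into
-- `w ∘ (suc k ∷_)`. The length bound is separate from the degree because the recursion of
-- `decreasingLists` lowers it by one per part.
weightedSum : ℕ → ℕ → (List ℕ → ℤ) → ℕ → ℤ
weightedSum l k w n = sumOver (decreasingLists l k) λ xs → indicator (sum xs ℕ.≟ n) ℤ.* w xs

weightedSum-suc : ∀ l k w n → weightedSum (suc l) (suc k) w n ≡ weightedSum (suc l) k w n ℤ.+
  sumOver (decreasingLists l (suc k)) (λ xs → indicator (suc k ℕ.+ sum xs ℕ.≟ n) ℤ.* w (suc k ∷ xs))
weightedSum-suc l k w n = trans
  (sumOver-++ (decreasingLists (suc l) k) (map (suc k ∷_) (decreasingLists l (suc k))) _)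
  (cong (λ z → weightedSum (suc l) k w n ℤ.+ z) (sumOver-map (suc k ∷_) (decreasingLists l (suc k)) _))

weightedSum-suc-< : ∀ l k w n → n < suc k → weightedSum (suc l) (suc k) w n ≡ weightedSum (suc l) k w n
weightedSum-suc-< l k w n n<k = trans (weightedSum-suc l k w n) (trans
  (cong (λ z → weightedSum (suc l) k w n ℤ.+ z) (trans
    (sumOver-cong (decreasingLists l (suc k)) λ {xs} _ → cong (ℤ._* w (suc k ∷ xs))
      (indicator-false (suc k ℕ.+ sum xs ℕ.≟ n)
        λ e → ℕₚ.<⇒≱ n<k (ℕₚ.≤-trans (ℕₚ.m≤m+n (suc k) (sum xs)) (ℕₚ.≤-reflexive e))))
    (sumOver-0 (decreasingLists l (suc k)))))
  (ℤₚ.+-identityʳ _))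

weightedSum-suc-≥ : ∀ l k w m → weightedSum (suc l) (suc k) w (suc k ℕ.+ m)
  ≡ weightedSum (suc l) k w (suc k ℕ.+ m) ℤ.+ weightedSum l (suc k) (w ∘ (suc k ∷_)) m
weightedSum-suc-≥ l k w m = trans (weightedSum-suc l k w (suc k ℕ.+ m))
  (cong (λ z → weightedSum (suc l) k w (suc k ℕ.+ m) ℤ.+ z)
    (sumOver-cong (decreasingLists l (suc k)) λ {xs} _ → cong (ℤ._* w (suc k ∷ xs))
      (indicator-cong (suc k ℕ.+ sum xs ℕ.≟ suc k ℕ.+ m) (sum xs ℕ.≟ m)
        (ℕₚ.+-cancelˡ-≡ (suc k) (sum xs) m) (cong (suc k ℕ.+_)))))

data Split (k : ℕ) : ℕ → Set where
  below : ∀ {n} → n < k → Split k n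
  above : ∀ m → Split k (k ℕ.+ m)

split : ∀ k n → Split k n
split k n with k ℕ.≤? n
... | yes k≤n = subst (Split k) (ℕₚ.m+[n∸m]≡n k≤n) (above (n ∸ k))
... | no  k≰n = below (ℕₚ.≰⇒> k≰n)

weightedSum-0 : ∀ l k w → weightedSum l k w 0 ≡ weightedSum 0 0 w 0
weightedSum-0 zero    k       w = refl
weightedSum-0 (suc l) zero    w = refl
weightedSum-0 (suc l) (suc k) w = trans (weightedSum-suc-< l k w 0 (s≤s z≤n)) (weightedSum-0 (suc l) k w)

-- A partition of n has at most n parts. This is needed because removing a part k + 1 lowers the
-- degree by k + 1 but the length bound only by 1.
weightedSum-stable : ∀ l l′ k w n → n ≤ l → n ≤ l′ → weightedSum l k w n ≡ weightedSum l′ k w n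
weightedSum-stable l l′ k w zero _ _ = trans (weightedSum-0 l k w) (sym (weightedSum-0 l′ k w))
weightedSum-stable (suc l) (suc l′) zero    w (suc n) _ _ = refl
-- The degree is abstracted so that matching on `above m` can replace it by `suc k ℕ.+ m`; the two
-- bounds mention it and have to follow.
weightedSum-stable (suc l) (suc l′) (suc k) w (suc n) n≤l n≤l′ with suc n | split (suc k) (suc n) | n≤l | n≤l′
... | n | below n<k | n≤l | n≤l′ = begin
  weightedSum (suc l) (suc k) w n   ≡⟨ weightedSum-suc-< l k w n n<k ⟩
  weightedSum (suc l) k w n         ≡⟨ weightedSum-stable (suc l) (suc l′) k w n n≤l n≤l′ ⟩
  weightedSum (suc l′) k w n        ≡⟨ weightedSum-suc-< l′ k w n n<k ⟨
  weightedSum (suc l′) (suc k) w n  ∎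
  where open ≡-Reasoning
... | _ | above m | s≤s n≤l | s≤s n≤l′ = begin
  weightedSum (suc l) (suc k) w (suc k ℕ.+ m)
    ≡⟨ weightedSum-suc-≥ l k w m ⟩
  weightedSum (suc l) k w (suc k ℕ.+ m) ℤ.+ weightedSum l (suc k) (w ∘ (suc k ∷_)) m
    ≡⟨ cong₂ ℤ._+_ (weightedSum-stable (suc l) (suc l′) k w (suc k ℕ.+ m) (s≤s n≤l) (s≤s n≤l′))
         (weightedSum-stable l l′ (suc k) (w ∘ (suc k ∷_)) m
           (ℕₚ.≤-trans (ℕₚ.m≤n+m m k) n≤l) (ℕₚ.≤-trans (ℕₚ.m≤n+m m k) n≤l′)) ⟩
  weightedSum (suc l′) k w (suc k ℕ.+ m) ℤ.+ weightedSum l′ (suc k) (w ∘ (suc k ∷_)) m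
    ≡⟨ weightedSum-suc-≥ l′ k w m ⟨
  weightedSum (suc l′) (suc k) w (suc k ℕ.+ m) ∎
  where open ≡-Reasoning

-- ∑ w(λ) q^|λ| over the partitions λ with parts at most k
gf : ℕ → (List ℕ → ℤ) → Series
gf k w n = weightedSum n k w n

gf-0 : ∀ w → gf 0 w ≋ const (w [])
gf-0 w = coeffs λ
  { zero    → trans (ℤₚ.+-identityʳ _) (ℤₚ.*-identityˡ (w []))
  ; (suc n) → refl }

opaque
  unfolding _+_

  q*-coeff : ∀ f n → (q * f) (suc n) ≡ f n
  q*-coeff f n = trans (*ₛ-sucˡ q f n) (trans (ℤₚ.+-identityˡ _)
    (trans (*ₛ-coeff-cong {q ∘ suc} {1ₛ} {f} {f} n (λ { zero _ → refl ; (suc _) _ → refl }) (λ _ _ → refl))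
      (coeff (*-identityˡ f) n)))

  const-*-coeff : ∀ c f n → (const c * f) n ≡ c ℤ.* f n
  const-*-coeff c f zero    = ℤₚ.+-identityˡ _
  const-*-coeff c f (suc n) = trans (*ₛ-sucˡ (const c) f n)
    (trans (cong (λ z → c ℤ.* f (suc n) ℤ.+ z) (∑<-zero (suc n) λ _ _ → refl)) (ℤₚ.+-identityʳ _))

q^-*-coeff : ∀ j f n → (q ^ j * f) (j ℕ.+ n) ≡ f n
q^-*-coeff zero    f n = coeff (*-identityˡ f) n
q^-*-coeff (suc j) f n = begin
  (q ^ j * q * f) (suc (j ℕ.+ n))    ≡⟨ coeff (solve 3 (λ a b c → a :* b :* c := b :* (a :* c)) ≋-refl (q ^ j) q f) (suc (j ℕ.+ n)) ⟩
  (q * (q ^ j * f)) (suc (j ℕ.+ n))  ≡⟨ q*-coeff (q ^ j * f) (j ℕ.+ n) ⟩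
  (q ^ j * f) (j ℕ.+ n)              ≡⟨ q^-*-coeff j f n ⟩
  f n                                ∎
  where open ≡-Reasoning; open SeriesSolver

q^-*-vanishes : ∀ j f → Vanishes j (q ^ j * f)
q^-*-vanishes j f = *-vanishesˡ (q ^ j) f (^-vanishes q refl j)

gf-suc-coeff-< : ∀ k w n → n < suc k → gf (suc k) w n ≡ gf k w n
gf-suc-coeff-< k w zero    _   = trans (weightedSum-0 0 (suc k) w) (sym (weightedSum-0 0 k w))
gf-suc-coeff-< k w (suc n) n<k = weightedSum-suc-< n k w (suc n) n<k

-- The second summand collects the partitions with largest part k + 1.
gf-suc : ∀ k w → gf (suc k) w ≋ gf k w + q ^ suc k * gf (suc k) (w ∘ (suc k ∷_))
gf-suc k w = coeffs λ n → trans (lemma n (split (suc k) n)) (sym (+-coeff (gf k w) (q ^ suc k * v) n))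
  where
  v = gf (suc k) (w ∘ (suc k ∷_))

  lemma : ∀ n → Split (suc k) n → gf (suc k) w n ≡ gf k w n ℤ.+ (q ^ suc k * v) n
  lemma n (below n<k) = trans (gf-suc-coeff-< k w n n<k) (sym (trans
    (cong (λ z → gf k w n ℤ.+ z) (q^-*-vanishes (suc k) v n n<k)) (ℤₚ.+-identityʳ _)))
  lemma _ (above m) = trans (weightedSum-suc-≥ (k ℕ.+ m) k w m)
    (cong (λ z → gf k w (suc k ℕ.+ m) ℤ.+ z) (trans
      (weightedSum-stable (k ℕ.+ m) m (suc k) (w ∘ (suc k ∷_)) m (ℕₚ.m≤n+m m k) ℕₚ.≤-refl)
      (sym (q^-*-coeff (suc k) v m))))

gf-bound : ∀ d n w → gf (d ℕ.+ n) w n ≡ gf n w n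
gf-bound zero    n w = refl
gf-bound (suc d) n w = trans (gf-suc-coeff-< (d ℕ.+ n) w n (s≤s (ℕₚ.m≤n+m n d))) (gf-bound d n w)

gf-coeff-cong : ∀ k n {w v} → (∀ xs → All (_≤ k) xs → sum xs ≡ n → w xs ≡ v xs) → gf k w n ≡ gf k v n
gf-coeff-cong k n {w} {v} e = sumOver-cong (decreasingLists n k) λ {xs} p →
  term xs (Bounded.parts≤ (∈-decreasingLists⁻ n k p))
  where
  term : ∀ xs → All (_≤ k) xs → indicator (sum xs ℕ.≟ n) ℤ.* w xs ≡ indicator (sum xs ℕ.≟ n) ℤ.* v xs
  term xs b with sum xs ℕ.≟ n
  ... | yes s = cong (1ℤ ℤ.*_) (e xs b s)
  ... | no  _ = refl

gf-cong : ∀ k {w v} → (∀ xs → All (_≤ k) xs → w xs ≡ v xs) → gf k w ≋ gf k v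
gf-cong k e = coeffs λ n → gf-coeff-cong k n λ xs b _ → e xs b

gf-zero : ∀ k {w} → (∀ xs → All (_≤ k) xs → w xs ≡ 0ℤ) → gf k w ≋ 0ₛ
gf-zero k e = ≋-trans (gf-cong k e) (coeffs λ n → trans
  (sumOver-cong (decreasingLists n k) λ {xs} _ → ℤₚ.*-zeroʳ (indicator (sum xs ℕ.≟ n)))
  (trans (sumOver-0 (decreasingLists n k)) (sym (0ₛ-coeff n))))

gf-+ : ∀ k w v → gf k (λ xs → w xs ℤ.+ v xs) ≋ gf k w + gf k v
gf-+ k w v = coeffs λ n → trans
  (sumOver-cong (decreasingLists n k) λ {xs} _ → ℤₚ.*-distribˡ-+ (indicator (sum xs ℕ.≟ n)) (w xs) (v xs))
  (trans (sumOver-+ (decreasingLists n k) _ _) (sym (+-coeff (gf k w) (gf k v) n)))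

gf-* : ∀ k c w → gf k (λ xs → c ℤ.* w xs) ≋ const c * gf k w
gf-* k c w = coeffs λ n → trans
  (sumOver-cong (decreasingLists n k) λ {xs} _ →
    solve 3 (λ i c w → i :* (c :* w) := c :* (i :* w)) refl (indicator (sum xs ℕ.≟ n)) c (w xs))
  (trans (sumOver-* (decreasingLists n k) c _) (sym (const-*-coeff c (gf k w) n)))
  where open +-*-Solver

gf-∑ : ∀ k (w : ℕ → List ℕ → ℤ) N → gf k (λ xs → ∑< N (λ m → w m xs)) ≋ ∑ (λ m → gf k (w m)) N
gf-∑ k w zero    = gf-zero k λ _ _ → refl
gf-∑ k w (suc N) = ≋-trans (gf-+ k (λ xs → ∑< N (λ m → w m xs)) (w N)) (+-cong (gf-∑ k w N) ≋-refl)

module _ {P : Pred (List ℕ) 0ℓ} (P? : Decidable P) where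

  ∑-filter-partitions : ∀ (f : List ℕ → ℕ) n →
    + sum (map f (filter P? (partitions n))) ≡ gf n (λ xs → indicator (P? xs) ℤ.* + f xs) n
  ∑-filter-partitions f n = trans (sumOver-sum f (filter P? (partitions n)))
    (trans (sumOver-filter P? (partitions n) _) (sumOver-filter (λ xs → sum xs ℕ.≟ n) (decreasingLists n n) _))

  length-filter-partitions : ∀ n → + length (filter P? (partitions n)) ≡ gf n (indicator ∘ P?) n
  length-filter-partitions n = trans (sumOver-length (filter P? (partitions n)))
    (trans (sumOver-filter P? (partitions n) _) (trans
      (sumOver-filter (λ xs → sum xs ℕ.≟ n) (decreasingLists n n) _)
      (sumOver-cong (decreasingLists n n) λ {xs} _ →
        cong (indicator (sum xs ℕ.≟ n) ℤ.*_) (ℤₚ.*-identityʳ (indicator (P? xs))))))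

-- Adding a part to a partition

fresh : ∀ {k xs} → All (_≤ k) xs → suc k ∉ xs
fresh b p = ℕₚ.1+n≰n (All.lookup b p)

multiplicity-≢ : ∀ {x j} → x ≢ j → ∀ xs → multiplicity x (j ∷ xs) ≡ multiplicity x xs
multiplicity-≢ {x} x≢j xs = cong length (filter-reject (x ℕ.≟_) {xs = xs} x≢j)

multiplicity-≡ : ∀ j xs → multiplicity j (j ∷ xs) ≡ suc (multiplicity j xs)
multiplicity-≡ j xs = cong length (filter-accept (j ℕ.≟_) {xs = xs} refl)

multiplicity-∷ : ∀ x j xs → multiplicity x xs ≤ multiplicity x (j ∷ xs)
multiplicity-∷ x j xs with x ℕ.≟ j
... | yes refl = ℕₚ.≤-trans (ℕₚ.n≤1+n _) (ℕₚ.≤-reflexive (sym (multiplicity-≡ x xs)))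
... | no  x≢j  = ℕₚ.≤-reflexive (sym (multiplicity-≢ x≢j xs))

∉⇒multiplicity≡0 : ∀ {j xs} → j ∉ xs → multiplicity j xs ≡ 0
∉⇒multiplicity≡0 {j} {xs} j∉ = cong length (filter-none (j ℕ.≟_) {xs = xs} (¬Any⇒All¬ xs j∉))

multiplicity≡0⇒∉ : ∀ {j xs} → multiplicity j xs ≤ 0 → j ∉ xs
multiplicity≡0⇒∉ {j} {xs} m≤0 j∈ with filter (j ℕ.≟_) xs | ∈-filter⁺ (j ℕ.≟_) j∈ refl
multiplicity≡0⇒∉ () j∈ | _ ∷ _ | _

∈-∷-≢ : ∀ {x j : ℕ} {xs} → x ≢ j → x ∈ j ∷ xs → x ∈ xs
∈-∷-≢ x≢j (here e)  = contradiction e x≢j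
∈-∷-≢ x≢j (there p) = p

-- Applied to weights v = w ∘ (suc k ∷_): once a part k + 1 that must not be repeated has been
-- taken, all remaining parts are at most k.
gf-suc-distinct : ∀ k {v v′} → (∀ xs → v (suc k ∷ xs) ≡ 0ℤ) → (∀ xs → suc k ∉ xs → v xs ≡ v′ xs) →
                  gf (suc k) v ≋ gf k v′
gf-suc-distinct k {v} {v′} v0 v≡v′ = begin
  gf (suc k) v                                       ≈⟨ gf-suc k v ⟩
  gf k v + q ^ suc k * gf (suc k) (v ∘ (suc k ∷_))   ≈⟨ +-cong (gf-cong k λ xs b → v≡v′ xs (fresh b)) (*-congˡ (gf-zero (suc k) λ xs _ → v0 xs)) ⟩
  gf k v′ + q ^ suc k * 0ₛ                           ≈⟨ solve 2 (λ a x → a :+ x :* con 0ℤ := a) ≋-refl (gf k v′) (q ^ suc k) ⟩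
  gf k v′                                            ∎
  where open ≋-Reasoning; open SeriesSolver

module Restricted {P : Pred ℕ 0ℓ} (P? : Decidable P) where

  noRepeated-tail : ∀ {j xs} → NoRepeated P (j ∷ xs) → NoRepeated P xs
  noRepeated-tail {j} {xs} (_ ∷ nr) = All.map (λ {x} h px → ℕₚ.≤-trans (multiplicity-∷ x j xs) (h px)) nr

  noRepeated-head : ∀ {j xs} → NoRepeated P (j ∷ xs) → P j → j ∉ xs
  noRepeated-head {j} {xs} (h ∷ _) pj =
    multiplicity≡0⇒∉ (ℕₚ.≤-pred (ℕₚ.≤-trans (ℕₚ.≤-reflexive (sym (multiplicity-≡ j xs))) (h pj)))

  noRepeated-∷ : ∀ {j xs} → (P j → j ∉ xs) → NoRepeated P xs → NoRepeated P (j ∷ xs)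
  noRepeated-∷ {j} {xs} new nr = head ∷ All.tabulate λ {x} x∈ px →
    ℕₚ.≤-trans (ℕₚ.≤-reflexive (multiplicity-≢ (λ { refl → new px x∈ }) xs)) (All.lookup nr x∈ px)
    where
    head : P j → multiplicity j (j ∷ xs) ≤ 1
    head pj = ℕₚ.≤-reflexive (trans (multiplicity-≡ j xs) (cong suc (∉⇒multiplicity≡0 (new pj))))

  contains? : ∀ R xs → Dec (All (_∈ xs) R)
  contains? R xs = All.all? (_∈? xs) R

  -- R lists prescribed parts: the empty R counts all partitions without repeated P-parts, and an
  -- initial run as R gives one summand of `moex` or `meex`.
  weight : List ℕ → List ℕ → ℤ
  weight R xs = indicator (noRepeated? P? xs ×-dec contains? R xs)

  contains-∷ : ∀ {j : ℕ} {xs : List ℕ} R → All (_∈ xs) R → All (_∈ j ∷ xs) R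
  contains-∷ R = All.map there

  contains-tail : ∀ {j : ℕ} {xs R : List ℕ} → j ∉ R → All (_∈ j ∷ xs) R → All (_∈ xs) R
  contains-tail j∉R c = All.tabulate λ x∈ → ∈-∷-≢ (λ { refl → j∉R x∈ }) (All.lookup c x∈)

  weight-∷ : ∀ {j xs R} → (P j → j ∉ xs) → j ∉ R → weight R (j ∷ xs) ≡ weight R xs
  weight-∷ {j} {xs} {R} new j∉R = indicator-cong
    (noRepeated? P? (j ∷ xs) ×-dec contains? R (j ∷ xs)) (noRepeated? P? xs ×-dec contains? R xs)
    (λ (nr , c) → noRepeated-tail nr , contains-tail j∉R c)
    (λ (nr , c) → noRepeated-∷ new nr , contains-∷ R c)

  weight-∷-required : ∀ {j xs R} → (P j → j ∉ xs) → j ∉ R → weight (j ∷ R) (j ∷ xs) ≡ weight R xs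
  weight-∷-required {j} {xs} {R} new j∉R = indicator-cong
    (noRepeated? P? (j ∷ xs) ×-dec contains? (j ∷ R) (j ∷ xs)) (noRepeated? P? xs ×-dec contains? R xs)
    (λ { (nr , _ ∷ c) → noRepeated-tail nr , contains-tail j∉R c })
    (λ (nr , c) → noRepeated-∷ new nr , here refl ∷ contains-∷ R c)

  weight-missing : ∀ {j xs R} → j ∉ xs → weight (j ∷ R) xs ≡ 0ℤ
  weight-missing {j} {xs} {R} j∉ = indicator-false (noRepeated? P? xs ×-dec contains? (j ∷ R) xs)
    λ { (_ , j∈ ∷ _) → j∉ j∈ }

  weight-repeated : ∀ {j xs R} → P j → weight R (j ∷ j ∷ xs) ≡ 0ℤ
  weight-repeated {j} {xs} {R} pj = indicator-false (noRepeated? P? (j ∷ j ∷ xs) ×-dec contains? R (j ∷ j ∷ xs))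
    λ (nr , _) → noRepeated-head nr pj (here refl)

  module _ (k : ℕ) {R : List ℕ} (j∉R : suc k ∉ R) where

    open SeriesSolver
    open ≋-Reasoning

    private
      x = q ^ suc k

    -- A part of unrestricted multiplicity contributes 1/(1 - x): deleting one copy gives G =
    -- `gf k (weight R)` + x G.
    gf-free : ¬ P (suc k) → gf (suc k) (weight R) * (1ₛ - x) ≋ gf k (weight R)
    gf-free ¬p = begin
      G * (1ₛ - x)                      ≈⟨ solve 2 (λ G x → G :* (con 1ℤ :- x) := G :- x :* G) ≋-refl G x ⟩
      G - x * G                         ≈⟨ +-cong recursion ≋-refl ⟩
      gf k (weight R) + x * G - x * G   ≈⟨ solve 2 (λ a b → a :+ b :- b := a) ≋-refl (gf k (weight R)) (x * G) ⟩
      gf k (weight R)                   ∎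
      where
      G = gf (suc k) (weight R)
      recursion : G ≋ gf k (weight R) + x * G
      recursion = ≋-trans (gf-suc k (weight R)) (+-cong ≋-refl (*-congˡ
        (gf-cong (suc k) λ xs _ → weight-∷ (λ p → contradiction p ¬p) j∉R)))

    gf-distinct : P (suc k) → gf (suc k) (weight R) ≋ gf k (weight R) * (1ₛ + x)
    gf-distinct p = begin
      gf (suc k) (weight R)                                       ≈⟨ gf-suc k (weight R) ⟩
      gf k (weight R) + x * gf (suc k) (weight R ∘ (suc k ∷_))    ≈⟨ +-cong ≋-refl (*-congˡ (gf-suc-distinct k
                                                                      (λ xs → weight-repeated p) (λ xs j∉ → weight-∷ (λ _ → j∉) j∉R))) ⟩
      gf k (weight R) + x * gf k (weight R)                       ≈⟨ solve 2 (λ a x → a :+ x :* a := a :* (con 1ℤ :+ x)) ≋-refl (gf k (weight R)) x ⟩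
      gf k (weight R) * (1ₛ + x)                                  ∎

    gf-required : ∀ {G} → gf (suc k) (weight (suc k ∷ R) ∘ (suc k ∷_)) ≋ G → gf (suc k) (weight (suc k ∷ R)) ≋ x * G
    gf-required {G} e = begin
      gf (suc k) (weight (suc k ∷ R))                                         ≈⟨ gf-suc k (weight (suc k ∷ R)) ⟩
      gf k (weight (suc k ∷ R)) + x * gf (suc k) (weight (suc k ∷ R) ∘ (suc k ∷_))
        ≈⟨ +-cong (gf-zero k λ xs b → weight-missing (fresh b)) (*-congˡ e) ⟩
      0ₛ + x * G                                                              ≈⟨ solve 1 (λ a → con 0ℤ :+ a := a) ≋-refl (x * G) ⟩
      x * G                                                                   ∎

    -- Deleting the obligatory copy still leaves any number of further copies.
    gf-required-free : ¬ P (suc k) → gf (suc k) (weight (suc k ∷ R)) ≋ x * gf (suc k) (weight R)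
    gf-required-free ¬p = gf-required (gf-cong (suc k) λ xs _ →
      weight-∷-required (λ p → contradiction p ¬p) j∉R)

    -- No second copy is allowed after the obligatory one, so x takes the place of the factor 1 + x
    -- in `gf-distinct`.
    gf-required-distinct : P (suc k) → gf (suc k) (weight (suc k ∷ R)) ≋ x * gf k (weight R)
    gf-required-distinct p = gf-required (gf-suc-distinct k
      (λ xs → weight-repeated p) (λ xs j∉ → weight-∷-required (λ _ → j∉) j∉R))

even-double : ∀ i → Even (i ℕ.* 2)
even-double i = divides i refl

odd-suc-double : ∀ i → Odd (suc (i ℕ.* 2))
odd-suc-double i = subst (Odd ∘ suc) (ℕₚ.*-comm 2 i) (odd-1+2* i)

odd⇒suc-double : ∀ m → Odd m → ∃ λ r → m ≡ suc (r ℕ.* 2)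
odd⇒suc-double zero          o = contradiction (2 ∣0) o
odd⇒suc-double (suc zero)    o = 0 , refl
odd⇒suc-double (suc (suc m)) o with odd⇒suc-double m (λ e → o (∣m∣n⇒∣m+n ∣-refl e))
... | r , refl = suc r , refl

q^-odd : ∀ N → q ^ suc (N ℕ.* 2) ≋ q * (q ^ 2) ^ N
q^-odd N = ≋-trans (*-congʳ (^-assoc q 2 N)) (*-comm ((q ^ 2) ^ N) q)

q^-even : ∀ N → q ^ (suc N ℕ.* 2) ≋ q ^ 2 * (q ^ 2) ^ N
q^-even N = ≋-trans (^-assoc q 2 (suc N)) (*-comm ((q ^ 2) ^ N) (q ^ 2))

1-cong : ∀ {f g} → f ≋ g → 1ₛ - f ≋ 1ₛ - g
1-cong e = +-cong ≋-refl (neg-cong e)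

1+≋1-neg : ∀ a b {f} → f ≋ a * b → 1ₛ + f ≋ 1ₛ - (- a) * b
1+≋1-neg a b e = ≋-trans (+-cong ≋-refl e)
  (solve 2 (λ a b → con 1ℤ :+ a :* b := con 1ℤ :- (:- a) :* b) ≋-refl a b)
  where open SeriesSolver

-- The generating functions of 𝒫od and 𝒫ed

module OD = Restricted odd?
module ED = Restricted even?

-- The bound advances by 2, admitting one odd and one even part, so that each step matches one
-- factor of each base-q² product.
pod-gf ped-gf : ℕ → Series
pod-gf N = gf (N ℕ.* 2) (OD.weight [])
ped-gf N = gf (N ℕ.* 2) (ED.weight [])

-- Kept apart from `pod-step` because R may contain 2N + 1 here: when that part is prescribed, only
-- the factor of the even part 2N + 2 has its usual form.
pod-even-step : ∀ N {R} → All (_≤ suc (N ℕ.* 2)) R →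
  gf (suc N ℕ.* 2) (OD.weight R) * (1ₛ - q ^ 2 * (q ^ 2) ^ N) ≋ gf (suc (N ℕ.* 2)) (OD.weight R)
pod-even-step N b = ≋-trans (*-congˡ (1-cong (≋-sym (q^-even N))))
  (OD.gf-free (suc (N ℕ.* 2)) (fresh b) (λ o → o (even-double (suc N))))

pod-step : ∀ N {R} → All (_≤ N ℕ.* 2) R →
  gf (suc N ℕ.* 2) (OD.weight R) * (1ₛ - q ^ 2 * (q ^ 2) ^ N) ≋
  gf (N ℕ.* 2) (OD.weight R) * (1ₛ - (- q) * (q ^ 2) ^ N)
pod-step N {R} b = ≋-trans (pod-even-step N (All.map ℕₚ.m≤n⇒m≤1+n b))
  (≋-trans (OD.gf-distinct (N ℕ.* 2) (fresh b) (odd-suc-double N)) (*-congˡ (1+≋1-neg q ((q ^ 2) ^ N) (q^-odd N))))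

ped-step : ∀ N → ped-gf (suc N) * (1ₛ - q * (q ^ 2) ^ N) ≋ ped-gf N * (1ₛ - (- (q ^ 2)) * (q ^ 2) ^ N)
ped-step N = begin
  ped-gf (suc N) * (1ₛ - q * X)
    ≈⟨ *-congʳ (≋-trans (ED.gf-distinct (suc (N ℕ.* 2)) (λ ()) (even-double (suc N))) (*-congˡ (1+≋1-neg (q ^ 2) X (q^-even N)))) ⟩
  G * (1ₛ - (- (q ^ 2)) * X) * (1ₛ - q * X)
    ≈⟨ solve 3 (λ a b c → a :* b :* c := a :* c :* b) ≋-refl G (1ₛ - (- (q ^ 2)) * X) (1ₛ - q * X) ⟩
  G * (1ₛ - q * X) * (1ₛ - (- (q ^ 2)) * X)
    ≈⟨ *-congʳ (≋-trans (*-congˡ (1-cong (≋-sym (q^-odd N)))) (ED.gf-free (N ℕ.* 2) (λ ()) (odd-suc-double N))) ⟩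
  ped-gf N * (1ₛ - (- (q ^ 2)) * X) ∎
  where
  open ≋-Reasoning
  open SeriesSolver
  X = (q ^ 2) ^ N
  G = gf (suc (N ℕ.* 2)) (ED.weight [])

pochhammer-quotient : ∀ (G : ℕ → Series) a a′ b → G 0 ≋ 1ₛ →
  (∀ N → G (suc N) * (1ₛ - a * b ^ N) ≋ G N * (1ₛ - a′ * b ^ N)) →
  ∀ N → G N * pochhammer a b N ≋ pochhammer a′ b N
pochhammer-quotient G a a′ b e step zero    = ≋-trans (*-congʳ e) (*-identityˡ 1ₛ)
pochhammer-quotient G a a′ b e step (suc N) = begin
  G (suc N) * (p * α)   ≈⟨ solve 3 (λ g p a → g :* (p :* a) := g :* a :* p) ≋-refl (G (suc N)) p α ⟩
  G (suc N) * α * p     ≈⟨ *-congʳ (step N) ⟩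
  G N * α′ * p          ≈⟨ solve 3 (λ g p a → g :* a :* p := g :* p :* a) ≋-refl (G N) p α′ ⟩
  G N * p * α′          ≈⟨ *-congʳ (pochhammer-quotient G a a′ b e step N) ⟩
  pochhammer a′ b N * α′ ∎
  where
  open ≋-Reasoning
  open SeriesSolver
  p = pochhammer a b N
  α = 1ₛ - a * b ^ N
  α′ = 1ₛ - a′ * b ^ N

pod-product : ∀ N → pod-gf N * pochhammer (q ^ 2) (q ^ 2) N ≋ pochhammer (- q) (q ^ 2) N
pod-product = pochhammer-quotient pod-gf (q ^ 2) (- q) (q ^ 2) (gf-0 (OD.weight [])) λ N → pod-step N []

ped-product : ∀ N → ped-gf N * pochhammer q (q ^ 2) N ≋ pochhammer (- (q ^ 2)) (q ^ 2) N
ped-product = pochhammer-quotient ped-gf q (- (q ^ 2)) (q ^ 2) (gf-0 (ED.weight [])) ped-step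

-- Prescribing an initial run of odd or even parts

-- The runs 1, 3, ..., 2m-1 (b = 1) and 2, 4, ..., 2m (b = 2), largest part first, because
-- generating functions are unfolded at the largest part.
staircase : ℕ → ℕ → List ℕ
staircase b zero    = []
staircase b (suc m) = b ℕ.+ m ℕ.* 2 ∷ staircase b m

staircase-bound : ∀ {b} → b ≤ 2 → ∀ m → All (_≤ m ℕ.* 2) (staircase b m)
staircase-bound b≤2 zero    = []
staircase-bound b≤2 (suc m) = ℕₚ.+-monoˡ-≤ (m ℕ.* 2) b≤2
  ∷ All.map (λ x≤ → ℕₚ.≤-trans x≤ (ℕₚ.m≤n+m (m ℕ.* 2) 2)) (staircase-bound b≤2 m)

q²-constant : (q ^ 2) 0 ≡ 0ℤ
q²-constant = coeff (^-defn q 2) 0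

even-factor-constant : ∀ N → (1ₛ - q ^ 2 * (q ^ 2) ^ N) 0 ≡ 1ℤ
even-factor-constant N = trans (+-coeff 1ₛ (- (q ^ 2 * (q ^ 2) ^ N)) 0) (cong (λ z → 1ℤ ℤ.+ z)
  (trans (neg-coeff (q ^ 2 * (q ^ 2) ^ N) 0) (cong ℤ.-_
    (*-vanishesˡ {1} (q ^ 2) ((q ^ 2) ^ N) (λ { zero _ → q²-constant ; (suc _) (s≤s ()) }) 0 (s≤s z≤n)))))

-- A relation between pod-gf and its analogue for prescribed parts R passes to
-- larger part bounds, since both satisfy pod-step.
pod-step-ratio : ∀ N {R} u v → All (_≤ N ℕ.* 2) R →
  gf (N ℕ.* 2) (OD.weight R) * u ≋ v * pod-gf N →
  gf (suc N ℕ.* 2) (OD.weight R) * u ≋ v * pod-gf (suc N)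
pod-step-ratio N {R} u v b e = *-cancelʳ ε (even-factor-constant N) (begin
  G′ * u * ε               ≈⟨ solve 3 (λ a b c → a :* b :* c := a :* c :* b) ≋-refl G′ u ε ⟩
  G′ * ε * u               ≈⟨ *-congʳ (pod-step N b) ⟩
  G * α * u                ≈⟨ solve 3 (λ a b c → a :* b :* c := a :* c :* b) ≋-refl G α u ⟩
  G * u * α                ≈⟨ *-congʳ e ⟩
  v * pod-gf N * α         ≈⟨ *-assoc v (pod-gf N) α ⟩
  v * (pod-gf N * α)       ≈⟨ *-congˡ (pod-step N []) ⟨
  v * (pod-gf (suc N) * ε) ≈⟨ *-assoc v (pod-gf (suc N)) ε ⟨
  v * pod-gf (suc N) * ε   ∎)
  where
  open ≋-Reasoning
  open SeriesSolver
  ε = 1ₛ - q ^ 2 * (q ^ 2) ^ N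
  α = 1ₛ - (- q) * (q ^ 2) ^ N
  G = gf (N ℕ.* 2) (OD.weight R)
  G′ = gf (suc N ℕ.* 2) (OD.weight R)

bound-+ : ∀ d {m} {xs : List ℕ} → All (_≤ m ℕ.* 2) xs → All (_≤ (d ℕ.+ m) ℕ.* 2) xs
bound-+ d {m} = All.map λ x≤ → ℕₚ.≤-trans x≤ (ℕₚ.*-monoˡ-≤ 2 (ℕₚ.m≤n+m m d))

-- Prescribing 2i - 1 replaces its factor 1 + q^(2i-1) by q^(2i-1); over the run this divides by
-- (-q;q²)_m and contributes 1 + 3 + ... + (2m-1) = m² to the exponent. The slack d lets the part
-- bound exceed the end of the run.
pod-odd-staircase : ∀ m d → gf ((d ℕ.+ m) ℕ.* 2) (OD.weight (staircase 1 m)) * pochhammer (- q) (q ^ 2) m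
                          ≋ q ^ (m ℕ.* m) * pod-gf (d ℕ.+ m)
pod-odd-staircase m (suc d) = pod-step-ratio (d ℕ.+ m) (pochhammer (- q) (q ^ 2) m) (q ^ (m ℕ.* m))
  (bound-+ d (staircase-bound (s≤s z≤n) m)) (pod-odd-staircase m d)
pod-odd-staircase zero    zero = *-comm (pod-gf 0) 1ₛ
pod-odd-staircase (suc m) zero = *-cancelʳ ε (even-factor-constant m) (begin
  G * (p * α) * ε
    ≈⟨ solve 4 (λ G p a e → G :* (p :* a) :* e := G :* e :* p :* a) ≋-refl G p α ε ⟩
  G * ε * p * α
    ≈⟨ *-congʳ (*-congʳ (≋-trans
         (pod-even-step m (ℕₚ.≤-refl ∷ All.map ℕₚ.m≤n⇒m≤1+n (staircase-bound (s≤s z≤n) m)))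
         (OD.gf-required-distinct (m ℕ.* 2) (fresh (staircase-bound (s≤s z≤n) m)) (odd-suc-double m)))) ⟩
  q ^ suc (m ℕ.* 2) * G₀ * p * α
    ≈⟨ *-congʳ (*-assoc (q ^ suc (m ℕ.* 2)) G₀ p) ⟩
  q ^ suc (m ℕ.* 2) * (G₀ * p) * α
    ≈⟨ *-congʳ (*-congˡ (pod-odd-staircase m 0)) ⟩
  q ^ suc (m ℕ.* 2) * (q ^ (m ℕ.* m) * pod-gf m) * α
    ≈⟨ solve 4 (λ a b c d → a :* (b :* c) :* d := a :* b :* (c :* d)) ≋-refl (q ^ suc (m ℕ.* 2)) (q ^ (m ℕ.* m)) (pod-gf m) α ⟩
  q ^ suc (m ℕ.* 2) * q ^ (m ℕ.* m) * (pod-gf m * α)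
    ≈⟨ *-cong (≋-sym (^-+ q (suc (m ℕ.* 2)) (m ℕ.* m))) (≋-sym (pod-step m [])) ⟩
  q ^ (suc (m ℕ.* 2) ℕ.+ m ℕ.* m) * (pod-gf (suc m) * ε)
    ≡⟨ cong (λ k → q ^ k * (pod-gf (suc m) * ε)) exponent ⟩
  q ^ (suc m ℕ.* suc m) * (pod-gf (suc m) * ε)
    ≈⟨ *-assoc (q ^ (suc m ℕ.* suc m)) (pod-gf (suc m)) ε ⟨
  q ^ (suc m ℕ.* suc m) * pod-gf (suc m) * ε ∎)
  where
  open ≋-Reasoning
  open SeriesSolver
  ε = 1ₛ - q ^ 2 * (q ^ 2) ^ m
  α = 1ₛ - (- q) * (q ^ 2) ^ m
  p = pochhammer (- q) (q ^ 2) m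
  G = gf (suc m ℕ.* 2) (OD.weight (staircase 1 (suc m)))
  G₀ = gf (m ℕ.* 2) (OD.weight (staircase 1 m))

  exponent : suc (m ℕ.* 2) ℕ.+ m ℕ.* m ≡ suc m ℕ.* suc m
  exponent = S.solve 1 (λ m → (S.con 1 S.:+ m S.:* S.con 2) S.:+ m S.:* m S.:= (S.con 1 S.:+ m) S.:* (S.con 1 S.:+ m)) refl m
    where module S = ℕ-Solver

-- Even parts may repeat, so prescribing 2i only multiplies by q^(2i), and 2 + 4 + ... + 2m =
-- m(m+1).
pod-even-staircase : ∀ m d → gf ((d ℕ.+ m) ℕ.* 2) (OD.weight (staircase 2 m)) ≋ q ^ (m ℕ.* suc m) * pod-gf (d ℕ.+ m)
pod-even-staircase m (suc d) = ≋-trans (≋-sym (*-identityʳ _))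
  (pod-step-ratio (d ℕ.+ m) 1ₛ (q ^ (m ℕ.* suc m)) (bound-+ d (staircase-bound ℕₚ.≤-refl m))
    (≋-trans (*-identityʳ _) (pod-even-staircase m d)))
pod-even-staircase zero    zero = ≋-sym (*-identityˡ (pod-gf 0))
pod-even-staircase (suc m) zero = begin
  gf (suc m ℕ.* 2) (OD.weight (staircase 2 (suc m)))
    ≈⟨ OD.gf-required-free (suc (m ℕ.* 2)) (fresh (All.map ℕₚ.m≤n⇒m≤1+n (staircase-bound ℕₚ.≤-refl m)))
         (λ o → o (even-double (suc m))) ⟩
  q ^ (suc m ℕ.* 2) * gf (suc m ℕ.* 2) (OD.weight (staircase 2 m))
    -- Slack 1: the part bound is already 2m + 2, while the remaining run ends at 2m.
    ≈⟨ *-congˡ (pod-even-staircase m 1) ⟩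
  q ^ (suc m ℕ.* 2) * (q ^ (m ℕ.* suc m) * pod-gf (suc m))
    ≈⟨ *-assoc (q ^ (suc m ℕ.* 2)) (q ^ (m ℕ.* suc m)) (pod-gf (suc m)) ⟨
  q ^ (suc m ℕ.* 2) * q ^ (m ℕ.* suc m) * pod-gf (suc m)
    ≈⟨ *-congʳ (^-+ q (suc m ℕ.* 2) (m ℕ.* suc m)) ⟨
  q ^ (suc m ℕ.* 2 ℕ.+ m ℕ.* suc m) * pod-gf (suc m)
    ≡⟨ cong (λ k → q ^ k * pod-gf (suc m)) exponent ⟩
  q ^ (suc m ℕ.* suc (suc m)) * pod-gf (suc m) ∎
  where
  open ≋-Reasoning
  exponent : suc m ℕ.* 2 ℕ.+ m ℕ.* suc m ≡ suc m ℕ.* suc (suc m)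
  exponent = S.solve 1 (λ m → (S.con 1 S.:+ m) S.:* S.con 2 S.:+ m S.:* (S.con 1 S.:+ m)
                         S.:= (S.con 1 S.:+ m) S.:* (S.con 2 S.:+ m)) refl m
    where module S = ℕ-Solver

-- The least missing part as a sum of indicators

∑<-indicator : ∀ (P : ℕ → Set) (P? : ∀ m → Dec (P m)) r d → (∀ m → m < r → P m) → (∀ m → r ≤ m → ¬ P m) →
               ∑< (d ℕ.+ r) (λ m → indicator (P? m)) ≡ + r
∑<-indicator P P? r (suc d) lo hi = trans
  (cong₂ ℤ._+_ (∑<-indicator P P? r d lo hi) (indicator-false (P? (d ℕ.+ r)) (hi (d ℕ.+ r) (ℕₚ.m≤n+m r d))))
  (ℤₚ.+-identityʳ (+ r))
∑<-indicator P P? zero    zero lo hi = refl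
-- The induction cannot continue with P, which still holds at r; below r it has the same indicators
-- as `_< r`, which does stop there.
∑<-indicator P P? (suc r) zero lo hi = trans
  (cong₂ ℤ._+_ (trans (∑<-cong r λ m m<r → trans (indicator-true (P? m) (lo m (ℕₚ.m<n⇒m<1+n m<r)))
                                                (sym (indicator-true (m ℕ.<? r) m<r)))
                      (∑<-indicator (_< r) (ℕ._<? r) r 0 (λ _ m<r → m<r) (λ m r≤m → ℕₚ.≤⇒≯ r≤m)))
               (indicator-true (P? r) (lo r ℕₚ.≤-refl)))
  (cong +_ (ℕₚ.+-comm r 1))

∈-staircase : ∀ b {i m} → i < m → b ℕ.+ i ℕ.* 2 ∈ staircase b m
∈-staircase b {i} {suc m} i<m with i ℕ.≟ m
... | yes refl = here refl
... | no  i≢m  = there (∈-staircase b (ℕₚ.≤∧≢⇒< (ℕₚ.≤-pred i<m) i≢m))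

staircase-All : ∀ {P : Pred ℕ 0ℓ} b m → (∀ i → i < m → P (b ℕ.+ i ℕ.* 2)) → All P (staircase b m)
staircase-All b zero    h = []
staircase-All b (suc m) h = h m ℕₚ.≤-refl ∷ staircase-All b m λ i i<m → h i (ℕₚ.m<n⇒m<1+n i<m)

-- With r the index of the first gap, the run of length m + 1 is contained in xs exactly when m < r.
∑<-staircase : ∀ b xs r {K} → r ≤ K → (∀ i → i < r → b ℕ.+ i ℕ.* 2 ∈ xs) → b ℕ.+ r ℕ.* 2 ∉ xs →
  ∑< K (λ m → indicator (OD.contains? (staircase b (suc m)) xs)) ≡ + r
∑<-staircase b xs r {K} r≤K run gap = subst
  (λ K → ∑< K (λ m → indicator (OD.contains? (staircase b (suc m)) xs)) ≡ + r) (ℕₚ.m∸n+n≡m r≤K)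
  (∑<-indicator (λ m → All (_∈ xs) (staircase b (suc m))) (λ m → OD.contains? (staircase b (suc m)) xs) r (K ∸ r)
    (λ m m<r → staircase-All b (suc m) λ i i≤m → run i (ℕₚ.≤-<-trans (ℕₚ.≤-pred i≤m) m<r))
    (λ m r≤m c → gap (All.lookup c (∈-staircase b (s≤s r≤m)))))

*2-cancel-≤ : ∀ r s → r ℕ.* 2 ≤ s ℕ.* 2 → r ≤ s
*2-cancel-≤ r s = ℕₚ.*-cancelʳ-≤ r s 2

moex-∑ : ∀ xs {K} → sum xs < K →
  + moex xs ≡ 1ℤ ℤ.+ + 2 ℤ.* ∑< K (λ m → indicator (OD.contains? (staircase 1 (suc m)) xs))
moex-∑ xs {K} s<K with moex xs | moex-least xs
... | m | isLeast (_ , o , m∉) minimal with odd⇒suc-double m o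
...   | r , refl = begin
  + suc (r ℕ.* 2)        ≡⟨ cong (λ z → + suc z) (ℕₚ.*-comm r 2) ⟩
  1ℤ ℤ.+ + (2 ℕ.* r)     ≡⟨ cong (λ z → 1ℤ ℤ.+ z) (ℤₚ.pos-* 2 r) ⟩
  1ℤ ℤ.+ + 2 ℤ.* + r     ≡⟨ cong (λ z → 1ℤ ℤ.+ + 2 ℤ.* z) (∑<-staircase 1 xs r (ℕₚ.<⇒≤ (ℕₚ.≤-<-trans r≤s s<K)) run m∉) ⟨
  1ℤ ℤ.+ + 2 ℤ.* ∑< K (λ m → indicator (OD.contains? (staircase 1 (suc m)) xs)) ∎
  where
  open ≡-Reasoning
  run : ∀ i → i < r → suc (i ℕ.* 2) ∈ xs
  run i i<r = decidable-stable (suc (i ℕ.* 2) ∈? xs) λ i∉ → ℕₚ.<⇒≱ i<r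
    (*2-cancel-≤ r i (ℕₚ.≤-pred (minimal (suc (i ℕ.* 2)) (s≤s z≤n , odd-suc-double i , i∉))))
  -- The odd number 2 `sum xs` + 1 exceeds every part and so bounds the least missing one; hence K
  -- terms see the whole run.
  r≤s : r ≤ sum xs
  r≤s = *2-cancel-≤ r (sum xs) (ℕₚ.≤-pred (minimal (suc (sum xs ℕ.* 2))
    (s≤s z≤n , odd-suc-double (sum xs) , >sum⇒∉ (s≤s (ℕₚ.m≤m*n (sum xs) 2)))))

meex-∑ : ∀ xs {K} → sum xs < K →
  + meex xs ≡ + 2 ℤ.* ∑< (suc K) (λ m → indicator (OD.contains? (staircase 2 m) xs))
meex-∑ xs {K} s<K with meex xs | meex-least xs
... | m | isLeast (0<m , divides zero refl , m∉) minimal = contradiction 0<m λ ()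
... | m | isLeast (_ , divides (suc r) refl , m∉) minimal = begin
  + (suc r ℕ.* 2)        ≡⟨ cong +_ (ℕₚ.*-comm (suc r) 2) ⟩
  + (2 ℕ.* suc r)        ≡⟨ ℤₚ.pos-* 2 (suc r) ⟩
  + 2 ℤ.* + suc r        ≡⟨ cong (λ z → + 2 ℤ.* (1ℤ ℤ.+ z)) (∑<-staircase 2 xs r (ℕₚ.<⇒≤ (ℕₚ.≤-<-trans r≤s s<K)) run m∉) ⟨
  + 2 ℤ.* (1ℤ ℤ.+ ∑< K (λ m → indicator (OD.contains? (staircase 2 (suc m)) xs)))
                         -- The empty run m = 0 is always contained and supplies the extra 1.
                         ≡⟨ cong (+ 2 ℤ.*_) (∑<-head K (λ m → indicator (OD.contains? (staircase 2 m) xs))) ⟨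
  + 2 ℤ.* ∑< (suc K) (λ m → indicator (OD.contains? (staircase 2 m) xs)) ∎
  where
  open ≡-Reasoning
  run : ∀ i → i < r → suc i ℕ.* 2 ∈ xs
  run i i<r = decidable-stable (suc i ℕ.* 2 ∈? xs) λ i∉ → ℕₚ.<⇒≱ i<r
    (ℕₚ.≤-pred (*2-cancel-≤ (suc r) (suc i) (minimal (suc i ℕ.* 2) (s≤s z≤n , even-double (suc i) , i∉))))
  r≤s : r ≤ sum xs
  r≤s = ℕₚ.≤-pred (*2-cancel-≤ (suc r) (suc (sum xs)) (minimal (suc (sum xs) ℕ.* 2)
    (s≤s z≤n , even-double (suc (sum xs)) , >sum⇒∉ (ℕₚ.m≤m*n (suc (sum xs)) 2))))

-- Both series in terms of truncated generating functions

weight-× : ∀ R xs → indicator (noRepeated? odd? xs) ℤ.* indicator (OD.contains? R xs) ≡ OD.weight R xs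
weight-× R xs = sym (indicator-× (noRepeated? odd? xs) (OD.contains? R xs))

*-∑<-weight : ∀ xs (R : ℕ → List ℕ) K →
  indicator (noRepeated? odd? xs) ℤ.* ∑< K (λ m → indicator (OD.contains? (R m) xs)) ≡ ∑< K (λ m → OD.weight (R m) xs)
*-∑<-weight xs R K = trans (∑<-*ˡ (indicator (noRepeated? odd? xs)) (λ m → indicator (OD.contains? (R m) xs)) K)
  (∑<-cong K λ m _ → weight-× (R m) xs)

-- No part of a partition of n exceeds n. The larger bound 2(n + 1) is the one built into
-- `pod-gf (suc n)` and `ped-gf (suc n)`.
gf-truncate : ∀ w n → gf n w n ≡ gf (suc n ℕ.* 2) w n
gf-truncate w n = trans (sym (gf-bound (suc n ℕ.* 2 ∸ n) n w))
  (cong (λ k → gf k w n) (ℕₚ.m∸n+n≡m (ℕₚ.≤-trans (ℕₚ.n≤1+n n) (ℕₚ.m≤m*n (suc n) 2))))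

∑-pod : ∀ f v n → (∀ xs → sum xs ≡ n → indicator (noRepeated? odd? xs) ℤ.* + f xs ≡ v xs) →
        + sum (map f (𝒫od n)) ≡ gf (suc n ℕ.* 2) v n
∑-pod f v n e = trans (∑-filter-partitions (noRepeated? odd?) f n)
  (trans (gf-coeff-cong n n λ xs _ → e xs) (gf-truncate v n))

moex-series : ∀ n → genFun σodmoex n ≡
  (pod-gf (suc n) * (1ₛ + const (+ 2) * ∑ (λ m → σ*-term (suc m) ⟨-q⟩) (suc n))) n
moex-series n = trans (∑-pod moex v n weights) (coeff series n)
  where
  K = suc n

  w : ℕ → List ℕ → ℤ
  w m = OD.weight (staircase 1 (suc m))

  v : List ℕ → ℤ
  v xs = OD.weight [] xs ℤ.+ + 2 ℤ.* ∑< K (λ m → w m xs)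

  weights : ∀ xs → sum xs ≡ n → indicator (noRepeated? odd? xs) ℤ.* + moex xs ≡ v xs
  weights xs refl = begin
    i ℤ.* + moex xs                          ≡⟨ cong (i ℤ.*_) (moex-∑ xs ℕₚ.≤-refl) ⟩
    i ℤ.* (1ℤ ℤ.+ + 2 ℤ.* s)                 ≡⟨ solve 2 (λ i s → i :* (con 1ℤ :+ con (+ 2) :* s) := i :* con 1ℤ :+ con (+ 2) :* (i :* s)) refl i s ⟩
    i ℤ.* 1ℤ ℤ.+ + 2 ℤ.* (i ℤ.* s)           ≡⟨ cong₂ (λ a b → a ℤ.+ + 2 ℤ.* b) (weight-× [] xs) (*-∑<-weight xs (λ m → staircase 1 (suc m)) K) ⟩
    v xs                                     ∎
    where
    open ≡-Reasoning
    open +-*-Solver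
    i = indicator (noRepeated? odd? xs)
    s = ∑< K (λ m → indicator (OD.contains? (staircase 1 (suc m)) xs))

  term : ∀ m → m < K → gf (K ℕ.* 2) (w m) ≋ pod-gf K * σ*-term (suc m) ⟨-q⟩
  -- Multiplied by (-q;q²)_(m+1), both sides are q^((m+1)²) `pod-gf K`.
  term m m<K = *-cancelʳ p (pochhammer-constant (- q) (q ^ 2) (neg-coeff q 0) (suc m)) (begin
    gf (K ℕ.* 2) (w m) * p                       ≈⟨ subst (λ N → gf (N ℕ.* 2) (w m) * p ≋ q ^ (suc m ℕ.* suc m) * pod-gf N)
                                                      (ℕₚ.m∸n+n≡m m<K) (pod-odd-staircase (suc m) (K ∸ suc m)) ⟩
    q ^ (suc m ℕ.* suc m) * pod-gf K             ≈⟨ *-congʳ (σ*-term-⟨-q⟩ (suc m)) ⟨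
    σ*-term (suc m) ⟨-q⟩ * p * pod-gf K          ≈⟨ solve 3 (λ a b c → a :* b :* c := c :* a :* b) ≋-refl (σ*-term (suc m) ⟨-q⟩) p (pod-gf K) ⟩
    pod-gf K * σ*-term (suc m) ⟨-q⟩ * p          ∎)
    where
    open ≋-Reasoning
    open SeriesSolver
    p = pochhammer (- q) (q ^ 2) (suc m)

  series : gf (K ℕ.* 2) v ≋ pod-gf K * (1ₛ + const (+ 2) * ∑ (λ m → σ*-term (suc m) ⟨-q⟩) K)
  series = begin
    gf (K ℕ.* 2) v
      ≈⟨ gf-+ (K ℕ.* 2) (OD.weight []) (λ xs → + 2 ℤ.* ∑< K (λ m → w m xs)) ⟩
    pod-gf K + gf (K ℕ.* 2) (λ xs → + 2 ℤ.* ∑< K (λ m → w m xs))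
      ≈⟨ +-cong ≋-refl (≋-trans (gf-* (K ℕ.* 2) (+ 2) (λ xs → ∑< K (λ m → w m xs))) (*-congˡ (gf-∑ (K ℕ.* 2) w K))) ⟩
    pod-gf K + const (+ 2) * ∑ (λ m → gf (K ℕ.* 2) (w m)) K
      ≈⟨ +-cong ≋-refl (*-congˡ (≋-trans (∑-cong K term) (*-distrib-∑ (pod-gf K) (λ m → σ*-term (suc m) ⟨-q⟩) K))) ⟩
    pod-gf K + const (+ 2) * (pod-gf K * S)
      ≈⟨ solve 2 (λ p s → p :+ con (+ 2) :* (p :* s) := p :* (con 1ℤ :+ con (+ 2) :* s)) ≋-refl (pod-gf K) S ⟩
    pod-gf K * (1ₛ + const (+ 2) * S) ∎
    where
    open ≋-Reasoning
    open SeriesSolver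
    S = ∑ (λ m → σ*-term (suc m) ⟨-q⟩) K

σ*-mod : ∀ N → σ* [-q] ≋[ N ] const (+ 2) * ∑ (λ m → σ*-term (suc m) ⟨-q⟩) N
σ*-mod N = begin
  σ* [-q]                                              ≈⟨ mod-fromExact (⟨-q⟩-defn σ*) ⟨
  σ* ⟨-q⟩                                              ≈⟨ mod-fromExact (⟨-q⟩-cong (*-defn (const (+ 2)) tail)) ⟨
  (const (+ 2) * tail) ⟨-q⟩                            ≈⟨ mod-⟨-q⟩ (mod-*-cong mod-refl (∑∞-mod (σ*-term ∘ suc) σ*-term-vanishes N)) ⟩
  (const (+ 2) * ∑ (σ*-term ∘ suc) N) ⟨-q⟩             ≈⟨ mod-fromExact (≋-trans (⟨-q⟩-* (const (+ 2)) (∑ (σ*-term ∘ suc) N))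
                                                            (*-cong (⟨-q⟩-const (+ 2)) (⟨-q⟩-∑ (σ*-term ∘ suc) N))) ⟩
  const (+ 2) * ∑ (λ m → σ*-term (suc m) ⟨-q⟩) N       ∎
  where
  open mod-Reasoning N
  tail = ∑∞ (σ*-term ∘ suc) (∑-converges (σ*-term ∘ suc) σ*-term-vanishes)

pod∞ : Series
pod∞ = poch∞ (-ₛ q) (q ^ₛ 2) refl /ₛ poch∞ (q ^ₛ 2) (q ^ₛ 2) refl

pod∞-mod : ∀ N → pod∞ ≋[ N ] pod-gf N
pod∞-mod N = mod-*-cancelʳ e e0 (begin
  pod∞ * e                                              ≈⟨ mod-*-cong mod-refl e≋ ⟨
  pod∞ * e∞                                             ≈⟨ mod-fromExact (*-congʳ (*-defn (poch∞ (-ₛ q) (q ^ₛ 2) refl) (inverse e∞))) ⟨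
  poch∞ (-ₛ q) (q ^ₛ 2) refl / e∞ * e∞                  ≈⟨ mod-fromExact (/-* (poch∞ (-ₛ q) (q ^ₛ 2) refl) e∞ refl) ⟩
  poch∞ (-ₛ q) (q ^ₛ 2) refl                            ≈⟨ poch∞-mod refl N (neg-defn q) (^-defn q 2) ⟩
  pochhammer (- q) (q ^ 2) N                            ≈⟨ mod-fromExact (pod-product N) ⟨
  pod-gf N * e                                          ∎)
  where
  open mod-Reasoning N
  e = pochhammer (q ^ 2) (q ^ 2) N
  e0 = pochhammer-constant (q ^ 2) (q ^ 2) q²-constant N
  e∞ = poch∞ (q ^ₛ 2) (q ^ₛ 2) refl
  e≋ : e∞ ≋[ N ] e
  e≋ = poch∞-mod refl N (^-defn q 2) (^-defn q 2)

meex-series : ∀ n → genFun σodmeex n ≡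
  (const (+ 2) * (pod-gf (suc n) * ∑ (λ m → q ^ (m ℕ.* suc m)) (suc (suc n)))) n
meex-series n = trans (∑-pod meex v n weights) (coeff series n)
  where
  K = suc n

  w : ℕ → List ℕ → ℤ
  w m = OD.weight (staircase 2 m)

  v : List ℕ → ℤ
  v xs = + 2 ℤ.* ∑< (suc K) (λ m → w m xs)

  weights : ∀ xs → sum xs ≡ n → indicator (noRepeated? odd? xs) ℤ.* + meex xs ≡ v xs
  weights xs refl = begin
    i ℤ.* + meex xs         ≡⟨ cong (i ℤ.*_) (meex-∑ xs ℕₚ.≤-refl) ⟩
    i ℤ.* (+ 2 ℤ.* s)       ≡⟨ solve 2 (λ i s → i :* (con (+ 2) :* s) := con (+ 2) :* (i :* s)) refl i s ⟩
    + 2 ℤ.* (i ℤ.* s)       ≡⟨ cong (+ 2 ℤ.*_) (*-∑<-weight xs (staircase 2) (suc K)) ⟩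
    v xs                    ∎
    where
    open ≡-Reasoning
    open +-*-Solver
    i = indicator (noRepeated? odd? xs)
    s = ∑< (suc K) (λ m → indicator (OD.contains? (staircase 2 m) xs))

  term : ∀ m → m < suc K → gf (K ℕ.* 2) (w m) ≋ pod-gf K * q ^ (m ℕ.* suc m)
  term m (s≤s m≤K) = ≋-trans
    (subst (λ N → gf (N ℕ.* 2) (w m) ≋ q ^ (m ℕ.* suc m) * pod-gf N) (ℕₚ.m∸n+n≡m m≤K) (pod-even-staircase m (K ∸ m)))
    (*-comm (q ^ (m ℕ.* suc m)) (pod-gf K))

  series : gf (K ℕ.* 2) v ≋ const (+ 2) * (pod-gf K * ∑ (λ m → q ^ (m ℕ.* suc m)) (suc K))
  series = ≋-trans (gf-* (K ℕ.* 2) (+ 2) (λ xs → ∑< (suc K) (λ m → w m xs))) (*-congˡ (≋-trans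
    (gf-∑ (K ℕ.* 2) w (suc K)) (≋-trans (∑-cong (suc K) term) (*-distrib-∑ (pod-gf K) (λ m → q ^ (m ℕ.* suc m)) (suc K)))))

-- From 𝒫od to 𝒫ed through the triangular sum

∑-mod : ∀ t → (∀ n → Vanishes n (t n)) → ∀ {N M} → N ≤ M → ∑ t M ≋[ N ] ∑ t N
∑-mod t v {N} {M} N≤M = coeffs< λ k k<N → begin
  ∑ t M k              ≡⟨ coeff (∑-defn t M) k ⟩
  partialSums t M k    ≡⟨ proj₂ (∑-converges t v k) M (ℕₚ.<-≤-trans k<N N≤M) ⟩
  partialSums t (suc k) k ≡⟨ proj₂ (∑-converges t v k) N k<N ⟨
  partialSums t N k    ≡⟨ coeff (∑-defn t N) k ⟨
  ∑ t N k              ∎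
  where open ≡-Reasoning

triangular-vanishes : ∀ m → Vanishes m (q ^ (m ℕ.* suc m))
triangular-vanishes m k k<m = ^-vanishes q refl (m ℕ.* suc m) k (ℕₚ.<-≤-trans k<m (ℕₚ.m≤m*n m (suc m)))

-- After multiplication by the denominators (q²;q²)_K and (q;q²)_K, the left side is (-q;q²)_K
-- (q;q²)_K = (q²;q⁴)_K times the triangular sum. Gauss's theorem makes this (q⁴;q⁴)_K = (q²;q²)_K
-- (-q²;q²)_K, which is what the right side becomes.
pod-triangular : ∀ n → pod-gf (suc n) * ∑ (λ m → q ^ (m ℕ.* suc m)) (suc (suc n)) ≋[ suc n ] ped-gf (suc n)
pod-triangular n = mod-*-cancelʳ (e * o) eo0 (begin
  pod-gf K * θ * (e * o)                        ≈⟨ mod-fromExact (solve 4 (λ p t e o → p :* t :* (e :* o) := o :* (p :* e) :* t) ≋-refl (pod-gf K) θ e o) ⟩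
  o * (pod-gf K * e) * θ                        ≈⟨ mod-*-cong (mod-fromExact (≋-trans (*-congˡ (pod-product K)) (pochhammer-conjugate q (q ^ 2) K))) θ≋ ⟩
  pochhammer (q ^ 2) ((q ^ 2) ^ 2) K * ∑ Triangular.trianglePair K
                                                ≈⟨ Triangular.gauss-mod n ⟩
  pochhammer ((q ^ 2) ^ 2) ((q ^ 2) ^ 2) K      ≈⟨ mod-fromExact (pochhammer-conjugate (q ^ 2) (q ^ 2) K) ⟨
  e * pochhammer (- (q ^ 2)) (q ^ 2) K          ≈⟨ mod-fromExact (*-congˡ (ped-product K)) ⟨
  e * (ped-gf K * o)                            ≈⟨ mod-fromExact (solve 3 (λ e p o → e :* (p :* o) := p :* (e :* o)) ≋-refl e (ped-gf K) o) ⟩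
  ped-gf K * (e * o)                            ∎)
  where
  open mod-Reasoning (suc n)
  open SeriesSolver
  K = suc n
  e = pochhammer (q ^ 2) (q ^ 2) K
  o = pochhammer q (q ^ 2) K
  θ = ∑ (λ m → q ^ (m ℕ.* suc m)) (suc K)

  θ≋ : θ ≋[ K ] ∑ Triangular.trianglePair K
  -- The partition side produces K + 1 terms and Shanks's identity 2K; as q^m divides the m-th term,
  -- both agree with the sum of K terms modulo q^K.
  θ≋ = mod-trans (∑-mod (λ m → q ^ (m ℕ.* suc m)) triangular-vanishes (ℕₚ.n≤1+n K))
    (mod-trans (mod-sym (∑-mod (λ m → q ^ (m ℕ.* suc m)) triangular-vanishes (ℕₚ.m≤m*n K 2)))
      (mod-fromExact (∑-trianglePair K)))

  eo0 : (e * o) 0 ≡ 1ℤ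
  eo0 = trans (coeff (*-defn e o) 0) (cong₂ (λ a b → 0ℤ ℤ.+ a ℤ.* b)
    (pochhammer-constant (q ^ 2) (q ^ 2) q²-constant K) (pochhammer-constant q (q ^ 2) refl K))

ped-series : ∀ n → genFun ped n ≡ ped-gf (suc n) n
ped-series n = trans (length-filter-partitions (noRepeated? even?) n) (trans
  (gf-coeff-cong n n λ xs _ _ → indicator-cong (noRepeated? even? xs) (noRepeated? even? xs ×-dec ED.contains? [] xs)
    (λ nr → nr , []) proj₁)
  (gf-truncate (ED.weight []) n))

theorem1p4 : (genFun σodmoex
    ≈ₛ (poch∞ (-ₛ q) (q ^ₛ 2) refl /ₛ poch∞ (q ^ₛ 2) (q ^ₛ 2) refl) *ₛ (1ₛ +ₛ σ* [-q]))
    × (genFun σodmeex ≈ₛ const (+ 2) *ₛ genFun ped)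
theorem1p4 = moex-part , meex-part
  where
  open ≡-Reasoning

  moex-part : genFun σodmoex ≈ₛ pod∞ *ₛ (1ₛ +ₛ σ* [-q])
  moex-part n = begin
    genFun σodmoex n                                ≡⟨ moex-series n ⟩
    (pod-gf (suc n) * (1ₛ + const (+ 2) * ∑ (λ m → σ*-term (suc m) ⟨-q⟩) (suc n))) n
      ≡⟨ coeff< (mod-*-cong (pod∞-mod (suc n)) (mod-+-cong mod-refl (σ*-mod (suc n)))) n ℕₚ.≤-refl ⟨
    (pod∞ * (1ₛ + σ* [-q])) n                       ≡⟨ coeff (*-congˡ (+-defn 1ₛ (σ* [-q]))) n ⟩
    (pod∞ * (1ₛ +ₛ σ* [-q])) n                      ≡⟨ coeff (*-defn pod∞ (1ₛ +ₛ σ* [-q])) n ⟩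
    (pod∞ *ₛ (1ₛ +ₛ σ* [-q])) n                     ∎

  meex-part : genFun σodmeex ≈ₛ const (+ 2) *ₛ genFun ped
  meex-part n = begin
    genFun σodmeex n
      ≡⟨ meex-series n ⟩
    (const (+ 2) * (pod-gf (suc n) * ∑ (λ m → q ^ (m ℕ.* suc m)) (suc (suc n)))) n
      ≡⟨ coeff< (mod-*-cong {f = const (+ 2)} mod-refl (pod-triangular n)) n ℕₚ.≤-refl ⟩
    (const (+ 2) * ped-gf (suc n)) n                ≡⟨ const-*-coeff (+ 2) (ped-gf (suc n)) n ⟩
    + 2 ℤ.* ped-gf (suc n) n                        ≡⟨ cong (+ 2 ℤ.*_) (ped-series n) ⟨
    + 2 ℤ.* genFun ped n                            ≡⟨ const-*-coeff (+ 2) (genFun ped) n ⟨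
    (const (+ 2) * genFun ped) n                    ≡⟨ coeff (*-defn (const (+ 2)) (genFun ped)) n ⟩
    (const (+ 2) *ₛ genFun ped) n                   ∎
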